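{- Every planar graph $G$ with $n$ vertices and $m\geq 3$ edges has at most $n+\frac{7}{3}m-2$ cliques.
   Context: All graphs are finite, simple and undirected. A clique is a (possibly empty) set of pairwise adjacent vertices; the number of cliques counts $\emptyset$ and single vertices. -}

module Defs where

open import Data.Nat using (ℕ; zero; suc; _+_; _*_; _≤ᵇ_; _<ᵇ_)
open import Data.Bool using (Bool; true; false; _∧_; _∨_; not; if_then_else_)
open import Data.Fin using (Fin; toℕ) renaming (zero to fz; suc to fs)
open import Data.Fin.Properties using (_≟_)
open import Data.Vec using (Vec; []; _∷_; lookup)
open import Data.List using (List; []; _∷_)
open import Data.List.Membership.Propositional using (_∈_)
open import Data.List.Relation.Unary.Unique.Propositional using (Unique)
open import Data.Product using (Σ; _×_; _,_; proj₁; proj₂)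
open import Function using (_∘_; _⇔_)
open import Relation.Binary.PropositionalEquality using (_≡_)
open import Relation.Nullary.Decidable using (⌊_⌋)

record Graph (n : ℕ) : Set where
  field
    adj    : Fin n → Fin n → Bool
    sym    : ∀ i j → adj i j ≡ adj j i
    irrefl : ∀ i → adj i i ≡ false
open Graph public

_==_ : ∀ {n} → Fin n → Fin n → Bool
i == j = ⌊ i ≟ j ⌋

countFin : ∀ {n} → (Fin n → Bool) → ℕ
countFin {zero}  p = 0
countFin {suc n} p = (if p fz then 1 else 0) + countFin (p ∘ fs)

allFinB : ∀ {n} → (Fin n → Bool) → Bool
allFinB {zero}  p = true
allFinB {suc n} p = p fz ∧ allFinB (p ∘ fs)

anyFinB : ∀ {n} → (Fin n → Bool) → Bool
anyFinB {zero}  p = false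
anyFinB {suc n} p = p fz ∨ anyFinB (p ∘ fs)

sumFin : ∀ {n} → (Fin n → ℕ) → ℕ
sumFin {zero}  f = 0
sumFin {suc n} f = f fz + sumFin (f ∘ fs)

countSubsets : ∀ {n} → (Vec Bool n → Bool) → ℕ
countSubsets {zero}  p = if p [] then 1 else 0
countSubsets {suc n} p = countSubsets (λ S → p (true ∷ S)) + countSubsets (λ S → p (false ∷ S))

edges : ∀ {n} → Graph n → ℕ
edges G = sumFin λ i → countFin λ j → (toℕ i <ᵇ toℕ j) ∧ adj G i j

isClique : ∀ {n} → Graph n → Vec Bool n → Bool
isClique G S = allFinB λ i → allFinB λ j →
  not (lookup S i ∧ lookup S j) ∨ (i == j) ∨ adj G i j

-- number of cliques (including ∅ and singletons)
cliques : ∀ {n} → Graph n → ℕ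
cliques G = countSubsets (isClique G)

reach : ∀ {n} → Graph n → ℕ → Fin n → Fin n → Bool
reach G zero    v u = v == u
reach G (suc k) v u = reach G k v u ∨ anyFinB (λ w → reach G k v w ∧ adj G w u)

-- number of connected components: vertices that are the least in their component
components : ∀ {n} → Graph n → ℕ
components {n} G = countFin λ v →
  allFinB λ u → not ((toℕ u <ᵇ toℕ v) ∧ reach G n u v)

isolated : ∀ {n} → Graph n → ℕ
isolated G = countFin λ v → allFinB λ u → not (adj G v u)

-- A rotation system: for every vertex v a cyclic ordering (given as a list
-- without repetitions) of exactly the neighbours of v.
record Rotation {n : ℕ} (G : Graph n) : Set where
  field
    rot      : Fin n → List (Fin n)
    unique   : ∀ v → Unique (rot v)
    complete : ∀ v u → (u ∈ rot v) ⇔ (adj G v u ≡ true)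
open Rotation public

-- cyclic successor of u in a list (u itself if u does not occur)
nextIn : ∀ {n} → List (Fin n) → Fin n → Fin n
nextIn []       u = u
nextIn (x ∷ xs) u = go (x ∷ xs)
  where
    go : List (Fin _) → Fin _
    go []           = u
    go (y ∷ [])     = if y == u then x else u
    go (y ∷ z ∷ ys) = if y == u then z else go (z ∷ ys)

Dart : ℕ → Set
Dart n = Fin n × Fin n

faceStep : ∀ {n} {G : Graph n} → Rotation G → Dart n → Dart n
faceStep R (u , v) = v , nextIn (rot R v) u

iter : ∀ {A : Set} → ℕ → (A → A) → A → A
iter zero    f x = x
iter (suc k) f x = f (iter k f x)

code : ∀ {n} → Dart n → ℕ
code {n} (u , v) = toℕ u * n + toℕ v

-- d is the least dart (w.r.t. code) of its face orbit (orbits have ≤ n*n darts)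
orbitMin : ∀ {n} {G : Graph n} → Rotation G → Dart n → Bool
orbitMin {n} R d = go (n * n)
  where
    go : ℕ → Bool
    go zero    = true
    go (suc k) = (code d ≤ᵇ code (iter k (faceStep R) d)) ∧ go k

faces : ∀ {n} {G : Graph n} → Rotation G → ℕ
faces {n} {G} R = sumFin λ u → countFin λ v → adj G u v ∧ orbitMin R (u , v)

-- Planar: G has a rotation system of genus 0 in every component, i.e.
-- Euler's formula V - E + F = 2 holds for each component with an edge
-- (isolated vertices contribute V = 1, F = 0); summed: n + F + iso = 2c + m.
Planar : ∀ {n} → Graph n → Set
Planar {n} G = Σ (Rotation G) λ R →
  n + faces R + isolated G ≡ 2 * components G + edges G

{-# OPTIONS --safe #-}
module Submission where

-- The bound only uses that planar graphs are sparse: a subgraph with k non-isolated vertices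
-- and e ≥ 1 edges, no component of which is a single edge, has e ≤ 3k − 6.  To see this, start
-- from Euler's formula for G and delete edges one at a time.  Deleting an edge composes the
-- face permutation with a transposition, so it changes the number of faces by ±1; if it
-- disconnects its ends, the two darts lay on a common face, which splits.  Hence
-- 2c + m ≤ n + f persists, where an isolated vertex counts as having one face.
--
-- Applied to a vertex, an edge or a triangle together with its common neighbourhood Z, sparsity
-- bounds the number of edges inside Z by 2|Z| − 3, |Z| − 1 and 0 respectively.  So G has no
-- 5-clique, and, writing m′ and n′ for the numbers of edges and vertices lying in triangles,
-- double counting gives  3 k₃ ≤ 4m′ − 3n′  and  6 k₄ ≤ 3 k₃ − m′.  With  m′ ≤ 3n′ − 6  these
-- yield  k₃ + k₄ ≤ (4/3) m′ − 3,  which is the claim since G has 1 + n + m cliques of size ≤ 2.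

open import Defs renaming (sym to adj-sym; irrefl to adj-irrefl)
open import Data.Nat using (ℕ; zero; suc; _+_; _*_; _≤_; _<_; _≤ᵇ_; _<ᵇ_; z≤n; s≤s; s≤s⁻¹)
open import Data.Nat.Properties hiding (_≟_; ≡ᵇ⇒≡; ≡⇒≡ᵇ)
open import Data.Nat.DivMod using (_/_; _%_; m≡m%n+[m/n]*n; m%n<n)
open import Data.Nat.Tactic.RingSolver using (solve-∀)
open import Algebra.Properties.CommutativeSemigroup +-commutativeSemigroup using (interchange)
open import Data.Bool using (Bool; true; false; _∧_; _∨_; not; if_then_else_)
open import Data.Bool.Properties using (T-≡; ∧-comm; ∧-zeroʳ; ¬-not)
open import Data.Empty using (⊥; ⊥-elim)
open import Data.Fin using (Fin; toℕ; combine) renaming (zero to fz; suc to fs)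
import Data.Fin.Properties as Fin
open import Data.List using (List; []; _∷_; _++_; map; allFin; tabulate; cartesianProduct)
import Data.List.Relation.Unary.All as All
open import Data.List.Relation.Unary.AllPairs using (_∷_)
open import Data.List.Relation.Unary.Any using (here; there)
open import Data.List.Relation.Unary.Unique.Propositional using (Unique)
open import Data.List.Membership.Propositional using (_∈_; _∉_)
open import Data.List.Membership.Propositional.Properties using (∈-map⁺; ∈-map⁻)
open import Data.Product using (∃-syntax; _×_; _,_; proj₁; proj₂; swap)
open import Data.Product.Properties using (≡-dec)
open import Data.Sum using (_⊎_; inj₁; inj₂)
open import Data.Vec using (Vec; []; _∷_; lookup)
open import Function using (_∘_; id; Equivalence)
open import Relation.Binary.Definitions using (DecidableEquality; tri<; tri≈; tri>)
open import Relation.Binary.PropositionalEquality using (_≡_; refl; sym; trans; cong; cong₂; subst; subst₂; module ≡-Reasoning)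
open import Relation.Binary.Structures using (IsEquivalence)
open import Relation.Nullary using (¬_; Dec; yes; no)
open import Relation.Nullary.Decidable using (⌊_⌋)

-- Only an inequality is carried through the deletions: while the ends of a deleted edge stay
-- connected, all that is tracked of the face count is that it drops by at most one. This fixes the
-- direction in which the counts of `Planar` are compared with orbit counts: `components G` from
-- below, `faces R` from above. The terms 3 and 1 in the neighbourhood bounds require Z to have two
-- vertices, respectively one. This is why m′ and n′ replace m and n: at an edge or vertex lying in
-- a triangle these requirements hold, and elsewhere there is no triangle to count. The bounds for
-- edges and triangles follow from the one for vertices by coning: adding one of the common
-- neighbours to Z gives a set that still lies in the neighbourhoods of the others. For the final
-- constants, eliminate k₄ first: k₃ + k₄ ≤ (3/2) k₃ - m′/6 ≤ (11/6) m′ - (3/2) n′, and n′ ≥ m′/3 +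
-- 2 turns this into (4/3) m′ - 3. Darts and ordered tuples are counted throughout, so the
-- inequalities appear in the code multiplied by 2, 6 or 24.

private
  variable
    A B I : Set

-- Finite sums

𝟙 : Bool → ℕ
𝟙 b = if b then 1 else 0

𝟙-mono : ∀ {a b} → (a ≡ true → b ≡ true) → 𝟙 a ≤ 𝟙 b
𝟙-mono {false}         h = z≤n
𝟙-mono {true}  {true}  h = ≤-refl
𝟙-mono {true}  {false} h with () ← h refl

𝟙≤1 : ∀ b → 𝟙 b ≤ 1
𝟙≤1 true  = ≤-refl
𝟙≤1 false = z≤n

𝟙-∧ : ∀ a b → 𝟙 (a ∧ b) ≡ 𝟙 a * 𝟙 b
𝟙-∧ true  b = sym (+-identityʳ _)
𝟙-∧ false b = refl

∧-true : ∀ {a b} → a ∧ b ≡ true → a ≡ true × b ≡ true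
∧-true {true} {true} _ = refl , refl

∧-intro : ∀ {a b} → a ≡ true → b ≡ true → a ∧ b ≡ true
∧-intro refl refl = refl

∨-true : ∀ {a b} → a ∨ b ≡ true → a ≡ true ⊎ b ≡ true
∨-true {true}  _ = inj₁ refl
∨-true {false} p = inj₂ p

∨-introˡ : ∀ {a b} → a ≡ true → a ∨ b ≡ true
∨-introˡ refl = refl

∨-introʳ : ∀ {a b} → b ≡ true → a ∨ b ≡ true
∨-introʳ {true}  _ = refl
∨-introʳ {false} p = p

≢true : ∀ {b} → ¬ b ≡ true → b ≡ false
≢true = ¬-not

true⇔⇒≡ : ∀ {a b} → (a ≡ true → b ≡ true) → (b ≡ true → a ≡ true) → a ≡ b
true⇔⇒≡ {true}         f g = sym (f refl)
true⇔⇒≡ {false} {true} f g = g refl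
true⇔⇒≡ {false} {false} f g = refl

bool-cases : ∀ b → b ≡ true ⊎ b ≡ false
bool-cases true  = inj₁ refl
bool-cases false = inj₂ refl

⊥-bool : ∀ {b} {C : Set} → b ≡ true → b ≡ false → C
⊥-bool refl ()

∑L : List A → (A → ℕ) → ℕ
∑L []       f = 0
∑L (x ∷ xs) f = f x + ∑L xs f

∑L-cong : ∀ (xs : List A) {f g} → (∀ x → f x ≡ g x) → ∑L xs f ≡ ∑L xs g
∑L-cong []       h = refl
∑L-cong (x ∷ xs) h = cong₂ _+_ (h x) (∑L-cong xs h)

∑L-mono : ∀ (xs : List A) {f g} → (∀ x → f x ≤ g x) → ∑L xs f ≤ ∑L xs g
∑L-mono []       h = z≤n
∑L-mono (x ∷ xs) h = +-mono-≤ (h x) (∑L-mono xs h)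

∑L-+ : ∀ (xs : List A) f g → ∑L xs (λ x → f x + g x) ≡ ∑L xs f + ∑L xs g
∑L-+ []       f g = refl
∑L-+ (x ∷ xs) f g = trans (cong (f x + g x +_) (∑L-+ xs f g)) (interchange (f x) (g x) _ _)

∑L-0 : ∀ (xs : List A) → ∑L xs (λ _ → 0) ≡ 0
∑L-0 []       = refl
∑L-0 (x ∷ xs) = ∑L-0 xs

∑L-* : ∀ k (xs : List A) f → ∑L xs (λ x → k * f x) ≡ k * ∑L xs f
∑L-* k []       f = sym (*-zeroʳ k)
∑L-* k (x ∷ xs) f = trans (cong (k * f x +_) (∑L-* k xs f)) (sym (*-distribˡ-+ k (f x) _))

∑L-swap : ∀ (xs : List A) (ys : List B) (f : A → B → ℕ) →
  ∑L xs (λ x → ∑L ys (f x)) ≡ ∑L ys (λ y → ∑L xs (λ x → f x y))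
∑L-swap []       ys f = sym (∑L-0 ys)
∑L-swap (x ∷ xs) ys f = trans (cong (∑L ys (f x) +_) (∑L-swap xs ys f))
  (sym (∑L-+ ys (f x) _))

∑L-++ : ∀ (xs ys : List A) f → ∑L (xs ++ ys) f ≡ ∑L xs f + ∑L ys f
∑L-++ []       ys f = refl
∑L-++ (x ∷ xs) ys f = trans (cong (f x +_) (∑L-++ xs ys f)) (sym (+-assoc (f x) _ _))

∑L-map : ∀ (g : A → B) xs f → ∑L (map g xs) f ≡ ∑L xs (f ∘ g)
∑L-map g []       f = refl
∑L-map g (x ∷ xs) f = cong (f (g x) +_) (∑L-map g xs f)

∑L-cartesianProduct : ∀ (xs : List A) (ys : List B) f →
  ∑L (cartesianProduct xs ys) f ≡ ∑L xs (λ x → ∑L ys (λ y → f (x , y)))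
∑L-cartesianProduct []       ys f = refl
∑L-cartesianProduct (x ∷ xs) ys f = trans (∑L-++ (map (x ,_) ys) _ f)
  (cong₂ _+_ (∑L-map (x ,_) ys f) (∑L-cartesianProduct xs ys f))

∑L-tabulate : ∀ {n} (g : Fin n → A) f → ∑L (tabulate g) f ≡ sumFin (f ∘ g)
∑L-tabulate {n = zero}  g f = refl
∑L-tabulate {n = suc n} g f = cong (f (g fz) +_) (∑L-tabulate (g ∘ fs) f)

-- `once` says in a single equation that the enumeration is complete and free of repetitions; as a
-- statement about sums it yields `∑-δ` directly.
record Finite (A : Set) : Set where
  field
    elems : List A
    _≟_   : DecidableEquality A
    once  : ∀ x → ∑L elems (λ y → 𝟙 ⌊ x ≟ y ⌋) ≡ 1

  _≡ᵇ_ : A → A → Bool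
  x ≡ᵇ y = ⌊ x ≟ y ⌋

  ≡ᵇ-sound : ∀ {x y} → x ≡ᵇ y ≡ true → x ≡ y
  ≡ᵇ-sound {x} {y} p with x ≟ y
  ... | yes q = q

  ≡ᵇ-complete : ∀ {x y} → x ≡ y → x ≡ᵇ y ≡ true
  ≡ᵇ-complete {x} {y} p with x ≟ y
  ... | yes _ = refl
  ... | no ¬p = ⊥-elim (¬p p)

  ≡ᵇ-refute : ∀ {x y} → ¬ x ≡ y → x ≡ᵇ y ≡ false
  ≡ᵇ-refute ¬p = ≢true (¬p ∘ ≡ᵇ-sound)

open Finite {{...}} public

opaque
  ∑ : {{Finite A}} → (A → ℕ) → ℕ
  ∑ = ∑L elems

  ∑-def : {{_ : Finite A}} (f : A → ℕ) → ∑ f ≡ ∑L elems f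
  ∑-def f = refl

syntax ∑ (λ x → e) = ∑[ x ] e
infix 5 ∑

count : {{Finite A}} → (A → Bool) → ℕ
count p = ∑[ x ] 𝟙 (p x)

module _ {{_ : Finite A}} where

  opaque
    unfolding ∑

    ∑-cong : {f g : A → ℕ} → (∀ x → f x ≡ g x) → ∑ f ≡ ∑ g
    ∑-cong = ∑L-cong elems

    ∑-mono : {f g : A → ℕ} → (∀ x → f x ≤ g x) → ∑ f ≤ ∑ g
    ∑-mono = ∑L-mono elems

    ∑-+ : (f g : A → ℕ) → ∑[ x ] (f x + g x) ≡ ∑ f + ∑ g
    ∑-+ = ∑L-+ elems

    ∑-* : ∀ k (f : A → ℕ) → ∑[ x ] (k * f x) ≡ k * ∑ f
    ∑-* k = ∑L-* k elems

  ∑-≡0 : {f : A → ℕ} → (∀ x → f x ≡ 0) → ∑ f ≡ 0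
  ∑-≡0 h = trans (∑-cong h) (trans (∑-def _) (∑L-0 elems))

  count-≡ᵇ : (x : A) → count (x ≡ᵇ_) ≡ 1
  count-≡ᵇ x = trans (∑-def _) (once x)

  ∑-δ : (x : A) (f : A → ℕ) → ∑[ y ] 𝟙 (x ≡ᵇ y) * f y ≡ f x
  ∑-δ x f = begin
    ∑[ y ] 𝟙 (x ≡ᵇ y) * f y ≡⟨ ∑-cong h ⟩
    ∑[ y ] f x * 𝟙 (x ≡ᵇ y) ≡⟨ ∑-* (f x) _ ⟩
    f x * (∑[ y ] 𝟙 (x ≡ᵇ y)) ≡⟨ cong (f x *_) (count-≡ᵇ x) ⟩
    f x * 1                 ≡⟨ *-identityʳ (f x) ⟩
    f x                     ∎
    where
    open ≡-Reasoning
    h : ∀ y → 𝟙 (x ≡ᵇ y) * f y ≡ f x * 𝟙 (x ≡ᵇ y)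
    h y with x ≟ y
    ... | yes refl = *-comm 1 (f x)
    ... | no _     = sym (*-zeroʳ (f x))

  ∑-term : (f : A → ℕ) (x : A) → f x ≤ ∑ f
  ∑-term f x = ≤-trans (≤-reflexive (sym (∑-δ x f))) (∑-mono h)
    where
    h : ∀ y → 𝟙 (x ≡ᵇ y) * f y ≤ f y
    h y with x ≡ᵇ y
    ... | true  = ≤-reflexive (+-identityʳ (f y))
    ... | false = z≤n

  findᵇ : (p : A → Bool) → (∃[ x ] p x ≡ true) ⊎ (∀ x → p x ≡ false)
  findᵇ p = found (search elems)
    where
    search : ∀ xs → (∃[ x ] p x ≡ true) ⊎ (∑L xs (𝟙 ∘ p) ≡ 0)
    search []       = inj₂ refl
    search (x ∷ xs) with bool-cases (p x)
    ... | inj₁ q = inj₁ (x , q)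
    ... | inj₂ q rewrite q = search xs
    found : (∃[ x ] p x ≡ true) ⊎ (∑L elems (𝟙 ∘ p) ≡ 0) → _
    found (inj₁ h) = inj₁ h
    found (inj₂ e) = inj₂ λ x → ≢true λ q →
      1+n≰n (≤-trans (≤-reflexive (sym (cong 𝟙 q)))
        (≤-trans (∑-term (𝟙 ∘ p) x) (≤-reflexive (trans (∑-def _) e))))

  count-≤1 : {p : A → Bool} {q : Bool} → (∀ x → p x ≡ true → q ≡ true) →
    (∀ x y → p x ≡ true → p y ≡ true → x ≡ y) → count p ≤ 𝟙 q
  count-≤1 {p} {q} h inj with findᵇ p
  ... | inj₂ none = ≤-trans (≤-reflexive (∑-≡0 (λ x → cong 𝟙 (none x)))) z≤n
  ... | inj₁ (x , px) = begin
    count p              ≤⟨ ∑-mono (λ y → 𝟙-mono (λ py → ≡ᵇ-complete (inj x y px py))) ⟩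
    ∑[ y ] 𝟙 (x ≡ᵇ y)    ≡⟨ count-≡ᵇ x ⟩
    1                    ≡⟨ cong 𝟙 (h x px) ⟨
    𝟙 q                  ∎
    where open ≤-Reasoning

  count-compl : (p q : A → Bool) → (∀ x → q x ≡ true → p x ≡ true) →
    count q + count (λ x → p x ∧ not (q x)) ≡ count p
  count-compl p q h = trans (sym (∑-+ _ _)) (∑-cong λ x → e (p x) (q x) (h x))
    where
    e : ∀ p q → (q ≡ true → p ≡ true) → 𝟙 q + 𝟙 (p ∧ not q) ≡ 𝟙 p
    e true  true  _ = refl
    e true  false _ = refl
    e false true  h with () ← h refl
    e false false _ = refl

opaque
  unfolding ∑

  ∑-swap : {{_ : Finite A}} {{_ : Finite B}} (f : A → B → ℕ) →
    ∑[ x ] ∑[ y ] f x y ≡ ∑[ y ] ∑[ x ] f x y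
  ∑-swap {{F}} {{F′}} = ∑L-swap (F .elems) (F′ .elems)

∑-fibres : {{_ : Finite A}} {{_ : Finite B}} (p : A → Bool) (f : A → B) →
  count p ≡ ∑[ y ] count (λ x → p x ∧ (f x ≡ᵇ y))
∑-fibres p f = trans (∑-cong h) (∑-swap _)
  where
  h : ∀ x → 𝟙 (p x) ≡ ∑[ y ] 𝟙 (p x ∧ (f x ≡ᵇ y))
  h x = sym (begin
    ∑[ y ] 𝟙 (p x ∧ (f x ≡ᵇ y))   ≡⟨ ∑-cong (λ y → 𝟙-∧ (p x) _) ⟩
    ∑[ y ] 𝟙 (p x) * 𝟙 (f x ≡ᵇ y) ≡⟨ ∑-* (𝟙 (p x)) _ ⟩
    𝟙 (p x) * (∑[ y ] 𝟙 (f x ≡ᵇ y)) ≡⟨ cong (𝟙 (p x) *_) (count-≡ᵇ (f x)) ⟩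
    𝟙 (p x) * 1                   ≡⟨ *-identityʳ _ ⟩
    𝟙 (p x)                       ∎)
    where open ≡-Reasoning

-- Sort the `x` by their image: each fibre holds at most one, and none unless `q` holds there.
count-injection : {{_ : Finite A}} {{_ : Finite B}} (p : A → Bool) (q : B → Bool) (f : A → B) →
  (∀ x → p x ≡ true → q (f x) ≡ true) →
  (∀ x y → p x ≡ true → p y ≡ true → f x ≡ f y → x ≡ y) → count p ≤ count q
count-injection p q f h inj = ≤-trans (≤-reflexive (∑-fibres p f)) (∑-mono λ y → count-≤1
  (λ x px → let (a , b) = ∧-true px in subst (λ t → q t ≡ true) (≡ᵇ-sound b) (h x a))
  (λ x x′ px px′ → let (a , b) = ∧-true px; (a′ , b′) = ∧-true px′ in
    inj x x′ a a′ (trans (≡ᵇ-sound b) (sym (≡ᵇ-sound b′)))))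

once-Fin : ∀ {n} (x : Fin n) → ∑L (allFin n) (λ y → 𝟙 ⌊ x Fin.≟ y ⌋) ≡ 1
once-Fin x = trans (∑L-tabulate id (λ y → 𝟙 ⌊ x Fin.≟ y ⌋)) (go x)
  where
  zeros : ∀ n → sumFin {n} (λ _ → 0) ≡ 0
  zeros zero    = refl
  zeros (suc n) = zeros n
  sumFin-cong : ∀ {n} {f g : Fin n → ℕ} → (∀ x → f x ≡ g x) → sumFin f ≡ sumFin g
  sumFin-cong {zero}  h = refl
  sumFin-cong {suc n} h = cong₂ _+_ (h fz) (sumFin-cong (h ∘ fs))
  step : ∀ {n} (x y : Fin n) → 𝟙 ⌊ fs x Fin.≟ fs y ⌋ ≡ 𝟙 ⌊ x Fin.≟ y ⌋
  step x y with x Fin.≟ y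
  ... | yes _ = refl
  ... | no  _ = refl
  go : ∀ {n} (x : Fin n) → sumFin (λ y → 𝟙 ⌊ x Fin.≟ y ⌋) ≡ 1
  go {suc n} fz     = cong suc (zeros n)
  go {suc n} (fs x) = trans (sumFin-cong (step x)) (go x)

module _ {{_ : Finite A}} {{_ : Finite B}} where

  private
    _≟×_ : DecidableEquality (A × B)
    _≟×_ = ≡-dec _≟_ _≟_

    ≟×-* : ∀ (p q : A × B) → 𝟙 ⌊ p ≟× q ⌋ ≡ 𝟙 (proj₁ p ≡ᵇ proj₁ q) * 𝟙 (proj₂ p ≡ᵇ proj₂ q)
    ≟×-* (x , y) (x′ , y′) with x ≟ x′
    ... | no _ = refl
    ... | yes refl with y ≟ y′
    ...   | yes refl = refl
    ...   | no _     = refl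

    once-× : (p : A × B) → ∑L (cartesianProduct elems elems) (λ q → 𝟙 ⌊ p ≟× q ⌋) ≡ 1
    once-× p@(x , y) = begin
      ∑L (cartesianProduct elems elems) (λ q → 𝟙 ⌊ p ≟× q ⌋)
        ≡⟨ ∑L-cartesianProduct elems elems (λ q → 𝟙 ⌊ p ≟× q ⌋) ⟩
      ∑L elems (λ x′ → ∑L elems (λ y′ → 𝟙 ⌊ p ≟× (x′ , y′) ⌋))
        ≡⟨ ∑L-cong elems (λ x′ → ∑L-cong elems (λ y′ → ≟×-* p (x′ , y′))) ⟩
      ∑L elems (λ x′ → ∑L elems (λ y′ → 𝟙 (x ≡ᵇ x′) * 𝟙 (y ≡ᵇ y′)))
        ≡⟨ ∑L-cong elems (λ x′ → trans (∑L-* (𝟙 (x ≡ᵇ x′)) elems (λ y′ → 𝟙 (y ≡ᵇ y′)))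
             (trans (cong (𝟙 (x ≡ᵇ x′) *_) (once y)) (*-identityʳ _))) ⟩
      ∑L elems (λ x′ → 𝟙 (x ≡ᵇ x′))
        ≡⟨ once x ⟩
      1 ∎
      where open ≡-Reasoning

  instance
    finite-× : Finite (A × B)
    finite-× = record { elems = cartesianProduct elems elems ; _≟_ = _≟×_ ; once = once-× }

  opaque
    unfolding ∑

    ∑-× : (f : A × B → ℕ) → ∑ f ≡ ∑[ x ] ∑[ y ] f (x , y)
    ∑-× = ∑L-cartesianProduct elems elems

instance
  finite-Fin : ∀ {n} → Finite (Fin n)
  finite-Fin {n} = record { elems = allFin n ; _≟_ = Fin._≟_ ; once = once-Fin }

∑-Fin : ∀ {n} (f : Fin n → ℕ) → ∑ f ≡ sumFin f
∑-Fin f = trans (∑-def f) (∑L-tabulate id f)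

count-Fin : ∀ {n} (p : Fin n → Bool) → countFin p ≡ count p
count-Fin p = trans (h p) (sym (∑-Fin _))
  where
  h : ∀ {n} (p : Fin n → Bool) → countFin p ≡ sumFin (𝟙 ∘ p)
  h {zero}  p = refl
  h {suc n} p = cong (𝟙 (p fz) +_) (h (p ∘ fs))

count-all : ∀ n → count (λ (_ : Fin n) → true) ≡ n
count-all n = trans (sym (count-Fin _)) (h n)
  where
  h : ∀ n → countFin {n} (λ _ → true) ≡ n
  h zero    = refl
  h (suc n) = cong suc (h n)

-- Counting equivalence classes

-- A partition is represented by an idempotent map `r` taking each point to the root of its class.
-- Merging redirects the class of `a` to the root of `b`, one union step of union-find.
merge : {{_ : Finite A}} → (A → A) → A → A → A → A
merge r a b x = if r x ≡ᵇ r a then r b else r x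

module _ {{_ : Finite A}} where

  merge-yes : ∀ (r : A → A) {a} b {x} → r x ≡ r a → merge r a b x ≡ r b
  merge-yes r b p rewrite ≡ᵇ-complete p = refl

  merge-no : ∀ (r : A → A) {a} b {x} → ¬ r x ≡ r a → merge r a b x ≡ r x
  merge-no r b p rewrite ≡ᵇ-refute p = refl

  merge-glues : ∀ (r : A → A) a b → merge r a b a ≡ merge r a b b
  merge-glues r a b = cases (r b ≟ r a)
    where
    cases : Dec (r b ≡ r a) → merge r a b a ≡ merge r a b b
    cases (yes p) = trans (merge-yes r b refl) (sym (merge-yes r b p))
    cases (no ¬p) = trans (merge-yes r b refl) (sym (merge-no r b ¬p))

  merge-cong : ∀ (r : A → A) a b {x y} → r x ≡ r y → merge r a b x ≡ merge r a b y
  merge-cong r a b p = cong (λ t → if t ≡ᵇ r a then r b else t) p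

  merge-idem : ∀ (r : A → A) a b → (∀ x → r (r x) ≡ r x) → ∀ x →
    merge r a b (merge r a b x) ≡ merge r a b x
  merge-idem r a b idem x = cases (r x ≟ r a)
    where
    m = merge r a b
    cases : Dec (r x ≡ r a) → m (m x) ≡ m x
    cases (yes p) = trans (cong m (merge-yes r b p)) (trans (merge-cong r a b (idem b))
      (trans (sym (merge-glues r a b)) (merge-cong r a b (sym p))))
    cases (no ¬p) = trans (cong m (merge-no r b ¬p)) (merge-cong r a b (idem x))

  merge-respects : ∀ {_~_ : A → A → Set} → IsEquivalence _~_ → ∀ (r : A → A) {a b} →
    (∀ x → r x ~ x) → a ~ b → ∀ x → merge r a b x ~ x
  merge-respects eq r {a} {b} r~ a~b x with r x ≟ r a
  ... | no  _ = r~ x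
  ... | yes p = E.trans (r~ b) (E.trans (E.sym a~b) (E.trans (E.sym (r~ a))
                  (E.trans (E.reflexive (sym p)) (r~ x))))
    where module E = IsEquivalence eq

  rep : List (A × A) → A → A
  rep []            = id
  rep ((a , b) ∷ l) = merge (rep l) a b

  rep-idem : ∀ l x → rep l (rep l x) ≡ rep l x
  rep-idem []            x = refl
  rep-idem ((a , b) ∷ l) x = merge-idem (rep l) a b (rep-idem l) x

  rep-∈ : ∀ l {a b} → (a , b) ∈ l → rep l a ≡ rep l b
  rep-∈ (_ ∷ l) (here refl) = merge-glues (rep l) _ _
  rep-∈ (_ ∷ l) (there p)   = merge-cong (rep l) _ _ (rep-∈ l p)

  -- Relating each point to its root is enough to place the kernel of `rep l` inside `_~_`: points
  -- with equal roots are related through that root.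
  rep-least : ∀ {_~_ : A → A → Set} → IsEquivalence _~_ → ∀ l →
    (∀ {a b} → (a , b) ∈ l → a ~ b) → ∀ x → rep l x ~ x
  rep-least eq []      h x = IsEquivalence.refl eq
  rep-least eq (_ ∷ l) h x =
    merge-respects eq (rep l) (rep-least eq l (h ∘ there)) (h (here refl)) x

  ∈-elems : (x : A) → x ∈ elems
  ∈-elems x = search elems (once x)
    where
    search : ∀ xs → ∑L xs (λ y → 𝟙 (x ≡ᵇ y)) ≡ 1 → x ∈ xs
    search (y ∷ xs) e with x ≟ y
    ... | yes p = here p
    ... | no  _ = there (search xs e)

  -- Classes are counted through their roots, the fixed points of `r`. The count is meant for a `P`
  -- that is constant on classes, so that `P` selects whole classes.
  classes : (A → Bool) → (A → A) → ℕ
  classes P r = count λ x → P x ∧ (r x ≡ᵇ x)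

  module _ (P : A → Bool) (r : A → A) (idem : ∀ x → r (r x) ≡ r x) where

    -- A coarser partition has no more classes: `r` maps roots of `r′` to roots of `r`, injectively,
    -- since two roots of `r′` with the same `r`-root are also in the same `r′`-class.
    classes-antitone : (r′ : A → A) → (∀ x → P x ≡ true → P (r x) ≡ true) →
      (∀ x y → r x ≡ r y → r′ x ≡ r′ y) → classes P r′ ≤ classes P r
    classes-antitone r′ Pr ker = count-injection _ _ r
      (λ x p → ∧-intro (Pr x (proj₁ (∧-true p))) (≡ᵇ-complete (idem x)))
      (λ x y p q e → trans (sym (≡ᵇ-sound (proj₂ (∧-true p))))
        (trans (ker x y e) (≡ᵇ-sound (proj₂ (∧-true q)))))

    -- The only root that a merge can destroy is `r a`.
    classes-merge-≤ : ∀ a b → classes P r ≤ classes P (merge r a b) + 1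
    classes-merge-≤ a b = begin
      classes P r                                                    ≤⟨ ∑-mono pt ⟩
      ∑[ x ] (𝟙 (P x ∧ (merge r a b x ≡ᵇ x)) + 𝟙 (r a ≡ᵇ x))         ≡⟨ ∑-+ _ _ ⟩
      classes P (merge r a b) + count (r a ≡ᵇ_)
        ≡⟨ cong (classes P (merge r a b) +_) (count-≡ᵇ (r a)) ⟩
      classes P (merge r a b) + 1                                    ∎
      where
      open ≤-Reasoning
      pt : ∀ x → 𝟙 (P x ∧ (r x ≡ᵇ x)) ≤ 𝟙 (P x ∧ (merge r a b x ≡ᵇ x)) + 𝟙 (r a ≡ᵇ x)
      pt x with r a ≟ x
      ... | yes _ = ≤-trans (𝟙≤1 _) (m≤n+m 1 _)
      ... | no ¬p = ≤-trans (𝟙-mono λ q → let (u , v) = ∧-true q; rx = ≡ᵇ-sound v in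
          ∧-intro u (≡ᵇ-complete (trans (merge-no r b (λ e → ¬p (trans (sym e) rx))) rx)))
        (m≤m+n _ 0)

    -- Between different classes the merge does destroy the root `r a`, which now points to `r b`,
    -- and it creates no new root.
    classes-merge-< : ∀ a b → ¬ r a ≡ r b → P (r a) ≡ true →
      classes P (merge r a b) + 1 ≤ classes P r
    classes-merge-< a b ra≢rb Pa = begin
      classes P (merge r a b) + 1
        ≡⟨ cong (classes P (merge r a b) +_) (count-≡ᵇ (r a)) ⟨
      classes P (merge r a b) + count (r a ≡ᵇ_)                      ≡⟨ ∑-+ _ _ ⟨
      ∑[ x ] (𝟙 (P x ∧ (merge r a b x ≡ᵇ x)) + 𝟙 (r a ≡ᵇ x))         ≤⟨ ∑-mono pt ⟩
      classes P r                                                    ∎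
      where
      open ≤-Reasoning
      pt : ∀ x → 𝟙 (P x ∧ (merge r a b x ≡ᵇ x)) + 𝟙 (r a ≡ᵇ x) ≤ 𝟙 (P x ∧ (r x ≡ᵇ x))
      pt x with r a ≟ x
      ... | yes refl rewrite merge-yes r b (idem a) | ≡ᵇ-refute (ra≢rb ∘ sym) | Pa
                           | ≡ᵇ-complete (idem a) = ≤-refl
      ... | no ¬p = ≤-trans (≤-reflexive (+-identityʳ _)) (𝟙-mono λ q →
          let (u , v) = ∧-true q in ∧-intro u (≡ᵇ-complete (fix (≡ᵇ-sound v))))
        where
        fix : merge r a b x ≡ x → r x ≡ x
        fix e with r x ≟ r a
        ... | yes p = ⊥-elim (ra≢rb (trans (sym p) (trans (cong r (sym e)) (idem b))))
        ... | no  _ = e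

-- The equivalence relation generated by the pairs `s i`, `t i`. It serves twice: for orbits, with
-- the pairs `x`, `f x`, and for connected components, with the two ends of each edge.
module Classes {{_ : Finite A}} {{_ : Finite I}} (s t : I → A) where

  private
    gens : List (A × A)
    gens = map (λ i → s i , t i) elems

  opaque
    cls : A → A
    cls = rep gens

    cls-idem : ∀ x → cls (cls x) ≡ cls x
    cls-idem = rep-idem gens

    cls-gen : ∀ i → cls (s i) ≡ cls (t i)
    cls-gen i = rep-∈ gens (∈-map⁺ (λ i → s i , t i) (∈-elems i))

    cls-least : ∀ {_~_ : A → A → Set} → IsEquivalence _~_ → (∀ i → s i ~ t i) → ∀ x → cls x ~ x
    cls-least {_~_} eq h = rep-least eq gens λ p →
      let (i , _ , e) = ∈-map⁻ (λ i → s i , t i) p in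
      subst₂ _~_ (sym (cong proj₁ e)) (sym (cong proj₂ e)) (h i)

  cls-invariant : (h : A → B) → (∀ i → h (s i) ≡ h (t i)) → ∀ x → h (cls x) ≡ h x
  cls-invariant h = cls-least record { refl = refl ; sym = sym ; trans = trans }

  cls-ker : (h : A → B) → (∀ i → h (s i) ≡ h (t i)) → ∀ x y → cls x ≡ cls y → h x ≡ h y
  cls-ker h inv x y e = trans (sym (cls-invariant h inv x)) (trans (cong h e) (cls-invariant h inv y))

-- Orbits of permutations of darts

iter-+ : ∀ (f : A → A) j k x → iter (j + k) f x ≡ iter j f (iter k f x)
iter-+ f zero    k x = refl
iter-+ f (suc j) k x = cong f (iter-+ f j k x)

iter-injective : ∀ {f : A → A} → (∀ {x y} → f x ≡ f y → x ≡ y) → ∀ k {x y} → iter k f x ≡ iter k f y → x ≡ y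
iter-injective inj zero    e = e
iter-injective inj (suc k) e = iter-injective inj k (inj e)

module _ {n} {f : Dart n → Dart n} (inj : ∀ {x y} → f x ≡ f y → x ≡ y) where

  -- Two of the first n² + 1 iterates coincide, and injectivity cancels the iterations common to
  -- both. The period is thus at most the cutoff `n * n` that `orbitMin` uses.
  injective⇒periodic : ∀ x → ∃[ p ] (suc p ≤ n * n × iter (suc p) f x ≡ x)
  injective⇒periodic x with Fin.pigeonhole (n<1+n (n * n))
    (λ i → let (u , v) = iter (toℕ i) f x in combine u v)
  ... | i , j , i<j , e with gap (toℕ i) (toℕ j) i<j
    where
    gap : ∀ a b → a < b → ∃[ o ] a + suc o ≡ b
    gap zero    (suc b) _ = b , refl
    gap (suc a) (suc b) h with gap a b (s≤s⁻¹ h)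
    ... | o , e = o , cong suc e
  ... | p , e′ = p
    , ≤-trans (m≤n+m (suc p) (toℕ i)) (≤-trans (≤-reflexive e′) (s≤s⁻¹ (Fin.toℕ<n j)))
    , iter-injective inj (toℕ i) (trans (sym (iter-+ f (toℕ i) (suc p) x))
        (trans (cong (λ k → iter k f x) e′) (sym eq)))
    where
    eq : iter (toℕ i) f x ≡ iter (toℕ j) f x
    eq = let (a , b) = Fin.combine-injective _ _ _ _ e in cong₂ _,_ a b

  iter-bounded : ∀ k x → ∃[ j ] (j < n * n × iter j f x ≡ iter k f x)
  iter-bounded k x with injective⇒periodic x
  ... | p , p≤ , per = k % suc p , <-≤-trans (m%n<n k (suc p)) p≤ , sym (begin
    iter k f x                                      ≡⟨ cong (λ t → iter t f x) (m≡m%n+[m/n]*n k (suc p)) ⟩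
    iter (k % suc p + k / suc p * suc p) f x        ≡⟨ iter-+ f (k % suc p) _ x ⟩
    iter (k % suc p) f (iter (k / suc p * suc p) f x) ≡⟨ cong (iter (k % suc p) f) (mult (k / suc p)) ⟩
    iter (k % suc p) f x                            ∎)
    where
    open ≡-Reasoning
    mult : ∀ q → iter (q * suc p) f x ≡ x
    mult zero    = refl
    mult (suc q) = trans (iter-+ f (suc p) (q * suc p) x) (trans (cong (iter (suc p) f) (mult q)) per)

  Reaches : Dart n → Dart n → Set
  Reaches x y = ∃[ k ] iter k f x ≡ y

  -- Symmetry is where periodicity enters: a step is undone by walking forward through the rest of
  -- the period.
  reaches-isEquivalence : IsEquivalence Reaches
  reaches-isEquivalence = record
    { refl  = 0 , refl
    ; sym   = reverse
    ; trans = compose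
    }
    where
    back : ∀ k x → Reaches (iter k f x) x
    back zero    x = 0 , refl
    back (suc k) x with back k x | injective⇒periodic (iter k f x)
    ... | j , e | p , _ , per = j + p , trans (iter-+ f j p _)
      (trans (cong (iter j f) (trans (shift p _) per)) e)
      where
      shift : ∀ p y → iter p f (f y) ≡ f (iter p f y)
      shift zero    y = refl
      shift (suc p) y = cong f (shift p y)
    reverse : ∀ {x y} → Reaches x y → Reaches y x
    reverse {x} (k , refl) = back k x
    compose : ∀ {x y z} → Reaches x y → Reaches y z → Reaches x z
    compose {x} (j , refl) (k , refl) = k + j , iter-+ f k j x

orbit : ∀ {n} → (Dart n → Dart n) → Dart n → Dart n
orbit f = Classes.cls id f

-- g is f composed with the transposition of e and e′.
module Transposition {n} (P : Dart n → Bool) (f g : Dart n → Dart n) (e e′ : Dart n)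
  (ge : g e ≡ f e′) (ge′ : g e′ ≡ f e) (g≡f : ∀ x → ¬ x ≡ e → ¬ x ≡ e′ → g x ≡ f x)
  (Pf : ∀ x → P (f x) ≡ P x) (Pg : ∀ x → P (g x) ≡ P x) where

  private
    module F = Classes id f
    module G = Classes id g

  -- Once `e` and `e′` are glued, the partition into `g`-orbits is invariant under `f` as well,
  -- hence at least as coarse as the `f`-orbits; the gluing costs at most one class.
  orbits-≤ : classes P (orbit g) ≤ classes P (orbit f) + 1
  orbits-≤ = ≤-trans (classes-merge-≤ P G.cls G.cls-idem e e′) (+-monoˡ-≤ 1
    (classes-antitone P F.cls F.cls-idem h (λ x p → trans (F.cls-invariant P (sym ∘ Pf) x) p)
      (F.cls-ker h inv)))
    where
    h = merge G.cls e e′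
    hg : ∀ x → h x ≡ h (g x)
    hg x = merge-cong G.cls e e′ (G.cls-gen x)
    inv : ∀ x → h x ≡ h (f x)
    inv x with x ≟ e | x ≟ e′
    ... | yes refl | _        = trans (merge-glues G.cls e e′) (trans (hg e′) (cong h ge′))
    ... | no _     | yes refl = trans (sym (merge-glues G.cls e e′)) (trans (hg e) (cong h ge))
    ... | no p     | no q     = trans (hg x) (cong h (g≡f x p q))

  -- If `e` and `e′` lie on different cycles of `f`, then `g` splices the two cycles into one. So
  -- the `g`-orbits are at least as coarse as the `f`-orbits with the classes of `e` and `e′`
  -- merged.
  orbits-< : (∀ {x y} → f x ≡ f y → x ≡ y) → P e ≡ true → ¬ orbit f e ≡ orbit f e′ →
    classes P (orbit g) + 1 ≤ classes P (orbit f)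
  orbits-< inj Pe e≁e′ = ≤-trans (+-monoˡ-≤ 1
      (classes-antitone P h (merge-idem F.cls e e′ F.cls-idem) G.cls
        (λ x p → trans (Ph x) p)
        (λ x y eq → trans (sym (Gh x)) (trans (cong G.cls eq) (Gh y)))))
    (classes-merge-< P F.cls F.cls-idem e e′ e≁e′ (trans (F.cls-invariant P (sym ∘ Pf) e) Pe))
    where
    h = merge F.cls e e′
    same : ∀ k → F.cls (iter k f e′) ≡ F.cls e′
    same zero    = refl
    same (suc k) = trans (sym (F.cls-gen _)) (same k)
    -- From `e`, `g` enters the `f`-cycle of `e′` at `f e′` and follows it until `e′` comes round;
    -- `e` is not on that cycle, so `g` agrees with `f` all the way.
    walk : ∀ k → G.cls e ≡ G.cls e′ ⊎ G.cls e ≡ G.cls (iter (suc k) f e′)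
    walk zero = inj₂ (trans (G.cls-gen e) (cong G.cls ge))
    walk (suc k) with walk k
    ... | inj₁ p = inj₁ p
    ... | inj₂ p with iter (suc k) f e′ ≟ e′ | iter (suc k) f e′ ≟ e
    ...   | yes q | _     = inj₁ (trans p (cong G.cls q))
    ...   | no _  | yes q = ⊥-elim (e≁e′ (trans (cong F.cls (sym q)) (same (suc k))))
    ...   | no q′ | no q  = inj₂ (trans p (trans (G.cls-gen _) (cong G.cls (g≡f _ q q′))))
    joined : G.cls e ≡ G.cls e′
    joined with injective⇒periodic inj e′
    ... | p , _ , per with walk p
    ...   | inj₁ q = q
    ...   | inj₂ q = trans q (cong G.cls per)
    Gf : ∀ x → G.cls x ≡ G.cls (f x)
    Gf x with x ≟ e | x ≟ e′
    ... | yes refl | _        = trans joined (trans (G.cls-gen e′) (cong G.cls ge′))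
    ... | no _     | yes refl = trans (sym joined) (trans (G.cls-gen e) (cong G.cls ge))
    ... | no p     | no q     = trans (G.cls-gen x) (cong G.cls (g≡f x p q))
    Gh : ∀ x → G.cls (h x) ≡ G.cls x
    Gh = merge-respects (record { refl = refl ; sym = sym ; trans = trans }) F.cls
      (F.cls-invariant G.cls Gf) joined
    Pe′ : P e ≡ P e′
    Pe′ = trans (sym (Pg e)) (trans (cong P ge) (Pf e′))
    Ph : ∀ x → P (h x) ≡ P x
    Ph = merge-respects (record { refl = refl ; sym = sym ; trans = trans }) F.cls
      (F.cls-invariant P (sym ∘ Pf)) Pe′

-- Rotations

-- A copy of the local function of nextIn: the successor of u in ys, wrapping around to x.
succIn : ∀ {n} → Fin n → Fin n → List (Fin n) → Fin n
succIn x u []           = u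
succIn x u (y ∷ [])     = if y == u then x else u
succIn x u (y ∷ z ∷ ys) = if y == u then z else succIn x u (z ∷ ys)

succIn-unique : ∀ {n} (x u : Fin n) (g : List (Fin n) → Fin n) → g [] ≡ u →
  (∀ y → g (y ∷ []) ≡ (if y == u then x else u)) →
  (∀ y z ys → g (y ∷ z ∷ ys) ≡ (if y == u then z else g (z ∷ ys))) → ∀ l → g l ≡ succIn x u l
succIn-unique x u g a b c []           = a
succIn-unique x u g a b c (y ∷ [])     = b y
succIn-unique x u g a b c (y ∷ z ∷ ys) = trans (c y z ys)
  (cong (λ t → if y == u then z else t) (succIn-unique x u g a b c (z ∷ ys)))

mutual
  -- The metavariable is solved by the nameless local function of nextIn, once the list
  -- it is applied to has been generalised.
  private
    nextIn-local : ∀ {n} → Fin n → Fin n → List (Fin n) → List (Fin n) → Fin n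
    nextIn-local = _

  nextIn≡succIn : ∀ {n} (x u : Fin n) xs → nextIn (x ∷ xs) u ≡ succIn x u (x ∷ xs)
  nextIn≡succIn x u xs with x ∷ xs
  ... | l = succIn-unique x u (nextIn-local x u xs) refl (λ _ → refl) (λ _ _ _ → refl) l

module _ {n} {x : Fin n} where

  succIn-here : ∀ y z ys → succIn x y (y ∷ z ∷ ys) ≡ z
  succIn-here y z ys with y Fin.≟ y
  ... | yes _ = refl
  ... | no ¬p = ⊥-elim (¬p refl)

  succIn-last : ∀ y → succIn x y (y ∷ []) ≡ x
  succIn-last y with y Fin.≟ y
  ... | yes _ = refl
  ... | no ¬p = ⊥-elim (¬p refl)

  succIn-there : ∀ {u y} z ys → ¬ y ≡ u → succIn x u (y ∷ z ∷ ys) ≡ succIn x u (z ∷ ys)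
  succIn-there {u} {y} z ys y≢u with y Fin.≟ u
  ... | yes p = ⊥-elim (y≢u p)
  ... | no _  = refl

  succIn-∉ : ∀ {u} ys → u ∉ ys → succIn x u ys ≡ u
  succIn-∉ []           _ = refl
  succIn-∉ {u} (y ∷ []) p with y Fin.≟ u
  ... | yes refl = ⊥-elim (p (here refl))
  ... | no _     = refl
  succIn-∉ {u} (y ∷ z ∷ ys) p = trans (succIn-there z ys (λ e → p (here (sym e))))
    (succIn-∉ (z ∷ ys) (p ∘ there))

  succIn-∈ : ∀ {u} y ys → u ∈ y ∷ ys → succIn x u (y ∷ ys) ∈ ys ⊎ succIn x u (y ∷ ys) ≡ x
  succIn-∈ y [] (here refl) = inj₂ (succIn-last y)
  succIn-∈ y (z ∷ ys) (here refl) = inj₁ (here (succIn-here y z ys))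
  succIn-∈ {u} y (z ∷ ys) (there p) with y Fin.≟ u
  ... | yes _ = inj₁ (here refl)
  ... | no _ with succIn-∈ z ys p
  ...   | inj₁ q = inj₁ (there q)
  ...   | inj₂ q = inj₂ q

  -- Here `x` stands for the head of the whole list and may be `y` itself, so only `ys` has to avoid
  -- it. The successor of the head is `z`, whereas later elements have successors beyond `z` or wrap
  -- around to `x`.
  succIn-injective : ∀ y ys → Unique (y ∷ ys) → x ∉ ys → ∀ {u u′} → u ∈ y ∷ ys → u′ ∈ y ∷ ys →
    succIn x u (y ∷ ys) ≡ succIn x u′ (y ∷ ys) → u ≡ u′
  succIn-injective y []       _ _ (here refl) (here refl) _ = refl
  succIn-injective y (z ∷ ys) _ _ (here refl) (here refl) _ = refl
  succIn-injective y (z ∷ ys) (a ∷ b ∷ q) x∉ (here refl) (there p′) e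
    with succIn-∈ z ys p′
       | trans (sym (succIn-here y z ys)) (trans e (succIn-there z ys (All.lookup a p′)))
  ... | inj₁ s | e′ = ⊥-elim (All.lookup b s e′)
  ... | inj₂ s | e′ = ⊥-elim (x∉ (here (sym (trans e′ s))))
  succIn-injective y (z ∷ ys) (a ∷ b ∷ q) x∉ (there p) (here refl) e
    with succIn-∈ z ys p
       | trans (sym (succIn-here y z ys)) (trans (sym e) (succIn-there z ys (All.lookup a p)))
  ... | inj₁ s | e′ = ⊥-elim (All.lookup b s e′)
  ... | inj₂ s | e′ = ⊥-elim (x∉ (here (sym (trans e′ s))))
  succIn-injective y (z ∷ ys) (a ∷ q) x∉ (there p) (there p′) e =
    succIn-injective z ys q (x∉ ∘ there) p p′
      (trans (sym (succIn-there z ys (All.lookup a p))) (trans e (succIn-there z ys (All.lookup a p′))))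

  module _ (Q : Fin n → Set) where

    succIn-forward : ∀ y ys → Unique (y ∷ ys) →
      (∀ w → w ∈ y ∷ ys → Q w → Q (succIn x w (y ∷ ys))) → Q y → ∀ {c} → c ∈ y ∷ ys → Q c
    succIn-forward y ys       _ H q (here refl) = q
    succIn-forward y (z ∷ ys) (a ∷ u) H q (there p) = succIn-forward z ys u
      (λ w w∈ qw → subst Q (succIn-there z ys (All.lookup a w∈)) (H w (there w∈) qw))
      (subst Q (succIn-here y z ys) (H y (here refl) q)) p

    succIn-wrap : ∀ y ys → Unique (y ∷ ys) →
      (∀ w → w ∈ y ∷ ys → Q w → Q (succIn x w (y ∷ ys))) → ∀ {a} → a ∈ y ∷ ys → Q a → Q x
    succIn-wrap y [] _ H (here refl) q = subst Q (succIn-last y) (H y (here refl) q)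
    succIn-wrap y (z ∷ ys) (a ∷ u) H p q = succIn-wrap z ys u
      (λ w w∈ qw → subst Q (succIn-there z ys (All.lookup a w∈)) (H w (there w∈) qw))
      (proj₁ (proj₂ moved)) (proj₂ (proj₂ moved))
      where
      move : ∀ {w} → w ∈ y ∷ z ∷ ys → Q w → ∃[ v ] (v ∈ z ∷ ys × Q v)
      move (here refl) q = z , here refl , subst Q (succIn-here y z ys) (H y (here refl) q)
      move (there p)   q = _ , p , q
      moved = move p q

nextIn-∉ : ∀ {n} (l : List (Fin n)) {u} → u ∉ l → nextIn l u ≡ u
nextIn-∉ []       p = refl
nextIn-∉ (x ∷ xs) p = trans (nextIn≡succIn x _ xs) (succIn-∉ (x ∷ xs) p)

nextIn-∈ : ∀ {n} (l : List (Fin n)) {u} → u ∈ l → nextIn l u ∈ l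
nextIn-∈ (x ∷ xs) {u} p with succIn-∈ {x = x} x xs p
... | inj₁ q = subst (_∈ x ∷ xs) (sym (nextIn≡succIn x u xs)) (there q)
... | inj₂ q = subst (_∈ x ∷ xs) (sym (nextIn≡succIn x u xs)) (here q)

nextIn-injective-∈ : ∀ {n} (l : List (Fin n)) → Unique l → ∀ {u v} → u ∈ l → v ∈ l →
  nextIn l u ≡ nextIn l v → u ≡ v
nextIn-injective-∈ (x ∷ xs) q@(a ∷ _) {u} {v} p p′ e =
  succIn-injective x xs q (λ x∈ → All.lookup a x∈ refl) p p′
    (trans (sym (nextIn≡succIn x u xs)) (trans e (nextIn≡succIn x v xs)))

-- The cyclic order is a single cycle, put as a propagation principle: a property closed under
-- successor travels from `a` past the end of the list to its head, and from the head to every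
-- element.
nextIn-transitive : ∀ {n} (l : List (Fin n)) → Unique l → (Q : Fin n → Set) →
  (∀ w → w ∈ l → Q w → Q (nextIn l w)) → ∀ {a c} → a ∈ l → Q a → c ∈ l → Q c
nextIn-transitive (x ∷ xs) u Q H a∈ qa = succIn-forward Q x xs u H′ (succIn-wrap Q x xs u H′ a∈ qa)
  where
  H′ : ∀ w → w ∈ x ∷ xs → Q w → Q (succIn x w (x ∷ xs))
  H′ w p q = subst Q (nextIn≡succIn x w xs) (H w p q)

-- Faces and components of a subgraph, and the deletion of an edge

module Embedding {n} (G : Graph n) (R : Rotation G) where

  isDart : Dart n → Bool
  isDart (u , v) = adj G u v

  next : Fin n → Fin n → Fin n
  next v = nextIn (rot R v)

  private
    ∈-rot : ∀ {v u} → adj G v u ≡ true → u ∈ rot R v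
    ∈-rot = Equivalence.from (complete R _ _)

    rot-∈ : ∀ {v u} → u ∈ rot R v → adj G v u ≡ true
    rot-∈ = Equivalence.to (complete R _ _)

  next-adj : ∀ v u → adj G v (next v u) ≡ adj G v u
  next-adj v u with bool-cases (adj G v u)
  ... | inj₁ p = trans (rot-∈ (nextIn-∈ _ (∈-rot p))) (sym p)
  ... | inj₂ p = cong (adj G v) (nextIn-∉ _ (λ q → ⊥-bool (rot-∈ q) p))

  -- Non-neighbours of `v` are fixed and neighbours go to neighbours, so `next v` permutes all
  -- vertices, and with it `ρ` all pairs of vertices.
  next-injective : ∀ v {u u′} → next v u ≡ next v u′ → u ≡ u′
  next-injective v {u} {u′} e with bool-cases (adj G v u) | bool-cases (adj G v u′)
  ... | inj₁ p | inj₁ q = nextIn-injective-∈ _ (unique R v) (∈-rot p) (∈-rot q) e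
  ... | inj₁ p | inj₂ q = ⊥-bool (trans (next-adj v u) p) (trans (cong (adj G v) e) (trans (next-adj v u′) q))
  ... | inj₂ p | inj₁ q = ⊥-bool (trans (next-adj v u′) q) (trans (cong (adj G v) (sym e)) (trans (next-adj v u) p))
  ... | inj₂ p | inj₂ q = trans (sym (nextIn-∉ _ (λ r → ⊥-bool (rot-∈ r) p)))
                            (trans e (nextIn-∉ _ (λ r → ⊥-bool (rot-∈ r) q)))

  next-transitive : ∀ v (Q : Fin n → Set) → (∀ w → adj G v w ≡ true → Q w → Q (next v w)) →
    ∀ {a c} → adj G v a ≡ true → Q a → adj G v c ≡ true → Q c
  next-transitive v Q H va qa vc =
    nextIn-transitive _ (unique R v) Q (λ w w∈ → H w (rot-∈ w∈)) (∈-rot va) qa (∈-rot vc)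

  ρ : Dart n → Dart n
  ρ (u , v) = u , next u v

  ρ-injective : ∀ {x y} → ρ x ≡ ρ y → x ≡ y
  ρ-injective {u , v} {u′ , v′} e with cong proj₁ e
  ... | refl = cong (u ,_) (next-injective u (cong proj₂ e))

  -- The face permutation of the subgraph T, acting on all darts of G: the darts outside
  -- T remain as markers of corners, so that an isolated vertex of T has its own orbit
  -- unless it is isolated in G.
  ψ : (Dart n → Bool) → Dart n → Dart n
  ψ T x = ρ (if T x then swap x else x)

  record IsSubgraph (T : Dart n → Bool) : Set where
    field
      symmetric : ∀ x → T (swap x) ≡ T x
      ⊆-darts   : ∀ x → T x ≡ true → isDart x ≡ true

    irreflexive : ∀ {u v} → T (u , v) ≡ true → ¬ u ≡ v
    irreflexive {u} Tuv refl = ⊥-bool (⊆-darts (u , u) Tuv) (adj-irrefl G u)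

  open IsSubgraph

  darts-isSubgraph : IsSubgraph isDart
  darts-isSubgraph = record { symmetric = λ (u , v) → adj-sym G v u ; ⊆-darts = λ _ p → p }

  ψ-in : ∀ T {u v} → T (u , v) ≡ true → ψ T (u , v) ≡ (v , next v u)
  ψ-in T p rewrite p = refl

  ψ-out : ∀ T {u v} → T (u , v) ≡ false → ψ T (u , v) ≡ (u , next u v)
  ψ-out T p rewrite p = refl

  -- `ψ T` is `ρ` after the involution that reverses exactly the darts of `T`.
  ψ-injective : ∀ {T} → IsSubgraph T → ∀ {x y} → ψ T x ≡ ψ T y → x ≡ y
  ψ-injective {T} S {x} {y} e = trans (sym (α-inv x)) (trans (cong α (ρ-injective e)) (α-inv y))
    where
    α : Dart n → Dart n
    α x = if T x then swap x else x
    α-inv : ∀ x → α (α x) ≡ x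
    α-inv x with bool-cases (T x)
    ... | inj₁ p rewrite p | symmetric S x | p = refl
    ... | inj₂ p rewrite p | p = refl

  ψ-isDart : ∀ T x → isDart (ψ T x) ≡ isDart x
  ψ-isDart T (u , v) with T (u , v)
  ... | true  = trans (next-adj v u) (adj-sym G v u)
  ... | false = next-adj u v

  -- A pair outside `T` contributes its source twice, a trivial generator; this lets all pairs of
  -- vertices serve as the index type.
  module Vertices (T : Dart n → Bool) = Classes {I = Dart n} proj₁ (λ x → if T x then proj₂ x else proj₁ x)

  component : (Dart n → Bool) → Fin n → Fin n
  component T = Vertices.cls T

  component-edge : ∀ T {u v} → T (u , v) ≡ true → component T u ≡ component T v
  component-edge T {u} {v} p = trans (Vertices.cls-gen T (u , v))
    (cong (λ b → component T (if b then v else u)) p)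

  component-invariant : ∀ T (h : Fin n → B) → (∀ u v → T (u , v) ≡ true → h u ≡ h v) →
    ∀ u → h (component T u) ≡ h u
  component-invariant T h inv = Vertices.cls-invariant T h λ (u , v) → e u v
    where
    e : ∀ u v → h u ≡ h (if T (u , v) then v else u)
    e u v with bool-cases (T (u , v))
    ... | inj₁ p rewrite p = inv u v p
    ... | inj₂ p rewrite p = refl

  face : (Dart n → Bool) → Dart n → Dart n
  face T = orbit (ψ T)

  module Orbits (T : Dart n → Bool) = Classes {I = Dart n} id (ψ T)

  -- `ψ T` is defined on all pairs of vertices; `isDart` discards the orbits of non-adjacent pairs,
  -- which by `ψ-isDart` never mix with those of darts.
  #components #faces : (Dart n → Bool) → ℕ
  #components T = classes (λ _ → true) (component T)
  #faces T      = classes isDart (face T)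

  remove : Dart n → (Dart n → Bool) → Dart n → Bool
  remove e T x = T x ∧ not ((e ≡ᵇ x) ∨ (swap e ≡ᵇ x))

  module Removal {T} (S : IsSubgraph T) (a b : Fin n) (Tab : T (a , b) ≡ true) where

    private
      e e′ : Dart n
      e  = a , b
      e′ = b , a

      T′ : Dart n → Bool
      T′ = remove e T

      e≢e′ : ¬ e ≡ e′
      e≢e′ p = irreflexive S Tab (cong proj₁ p)

      T′e : T′ e ≡ false
      T′e rewrite ≡ᵇ-complete {x = e} refl with T e
      ... | true = refl
      ... | false = refl

      T′e′ : T′ e′ ≡ false
      T′e′ rewrite ≡ᵇ-complete {x = e′} refl with T e′ | e ≡ᵇ e′
      ... | true  | true  = refl
      ... | true  | false = refl
      ... | false | _     = refl

      T′-other : ∀ x → ¬ x ≡ e → ¬ x ≡ e′ → T′ x ≡ T x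
      T′-other x p q rewrite ≡ᵇ-refute (p ∘ sym) | ≡ᵇ-refute (q ∘ sym) with T x
      ... | true  = refl
      ... | false = refl

      Te′ : T e′ ≡ true
      Te′ = trans (symmetric S e) Tab

    remove-isSubgraph : IsSubgraph T′
    remove-isSubgraph = record
      { symmetric = sy
      ; ⊆-darts   = λ x p → ⊆-darts S x (proj₁ (∧-true p))
      }
      where
      sy : ∀ x → T′ (swap x) ≡ T′ x
      sy x with x ≟ e | x ≟ e′
      ... | yes refl | _        = trans T′e′ (sym T′e)
      ... | no _     | yes refl = trans T′e (sym T′e′)
      ... | no p     | no q     = trans (T′-other (swap x) (λ r → q (cong swap r)) (λ r → p (cong swap r)))
                                    (trans (symmetric S x) (sym (T′-other x p q)))

    count-remove : count T ≡ count T′ + 2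
    count-remove = begin
      count T                                                      ≡⟨ ∑-cong pt ⟩
      ∑[ x ] (𝟙 (T′ x) + (𝟙 (e ≡ᵇ x) + 𝟙 (e′ ≡ᵇ x)))               ≡⟨ ∑-+ _ _ ⟩
      count T′ + (∑[ x ] (𝟙 (e ≡ᵇ x) + 𝟙 (e′ ≡ᵇ x)))               ≡⟨ cong (count T′ +_) (∑-+ _ _) ⟩
      count T′ + (count (e ≡ᵇ_) + count (e′ ≡ᵇ_))
        ≡⟨ cong (count T′ +_) (cong₂ _+_ (count-≡ᵇ e) (count-≡ᵇ e′)) ⟩
      count T′ + 2                                                 ∎
      where
      open ≡-Reasoning
      pt : ∀ x → 𝟙 (T x) ≡ 𝟙 (T′ x) + (𝟙 (e ≡ᵇ x) + 𝟙 (e′ ≡ᵇ x))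
      pt x = cases (x ≟ e) (x ≟ e′)
        where
        cases : Dec (x ≡ e) → Dec (x ≡ e′) → 𝟙 (T x) ≡ 𝟙 (T′ x) + (𝟙 (e ≡ᵇ x) + 𝟙 (e′ ≡ᵇ x))
        cases (yes refl) _ rewrite T′e | Tab | ≡ᵇ-complete {x = e} refl | ≡ᵇ-refute (e≢e′ ∘ sym) = refl
        cases (no _) (yes refl) rewrite T′e′ | Te′ | ≡ᵇ-complete {x = e′} refl | ≡ᵇ-refute e≢e′ = refl
        cases (no p) (no q) rewrite T′-other x p q | ≡ᵇ-refute (p ∘ sym) | ≡ᵇ-refute (q ∘ sym) =
          sym (+-identityʳ _)

    private
      -- Read backwards, deletion is insertion: the given permutation belongs to the smaller graph
      -- `T′`, and inserting the edge exchanges the images of its two darts.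
      module Tr = Transposition isDart (ψ T′) (ψ T) e e′
        (trans (ψ-in T Tab) (sym (ψ-out T′ T′e′)))
        (trans (ψ-in T Te′) (sym (ψ-out T′ T′e)))
        (λ x p q → cong (λ t → ρ (if t then swap x else x)) (sym (T′-other x p q)))
        (ψ-isDart T′) (ψ-isDart T)

      edge-cases : ∀ {C : Set} (h : Fin n → C) → h a ≡ h b → (∀ u v → T′ (u , v) ≡ true → h u ≡ h v) →
        ∀ u v → T (u , v) ≡ true → h u ≡ h v
      edge-cases h hab inv u v p with (u , v) ≟ e | (u , v) ≟ e′
      ... | yes refl | _        = hab
      ... | no _     | yes refl = sym hab
      ... | no q     | no r     = inv u v (trans (T′-other (u , v) q r) p)

      coarser : ∀ {C : Set} (h : Fin n → C) → h a ≡ h b → (∀ u v → T′ (u , v) ≡ true → h u ≡ h v) →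
        ∀ u v → component T u ≡ component T v → h u ≡ h v
      coarser h hab inv u v p = trans (sym (k u)) (trans (cong h p) (k v))
        where
        k = component-invariant T h (edge-cases h hab inv)

    -- The effect of one deletion on the terms of `Euler`. If the ends stay connected, no component
    -- is gained and at most one face is lost. Otherwise one component is gained at most, and a face
    -- is gained too, because `e` and `e′` lie on different orbits of `ψ T′`.
    components-faces : 4 * #components T′ + 2 * #faces T ≤ 4 * #components T + 2 * #faces T′ + 2
    components-faces with component T′ a ≟ component T′ b
    ... | yes p = begin
      4 * #components T′ + 2 * #faces T          ≤⟨ +-mono-≤ (*-monoʳ-≤ 4 c≤) (*-monoʳ-≤ 2 Tr.orbits-≤) ⟩
      4 * #components T + 2 * (#faces T′ + 1)    ≡⟨ ar (#components T) (#faces T′) ⟩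
      4 * #components T + 2 * #faces T′ + 2      ∎
      where
      open ≤-Reasoning
      ar : ∀ c z → 4 * c + 2 * (z + 1) ≡ 4 * c + 2 * z + 2
      ar = solve-∀
      c≤ : #components T′ ≤ #components T
      c≤ = classes-antitone _ (component T) (Vertices.cls-idem T) (component T′) (λ _ _ → refl)
        (coarser (component T′) p (λ u v → component-edge T′))
    ... | no ¬p = +-cancelʳ-≤ 2 _ _ (begin
      4 * #components T′ + 2 * #faces T + 2        ≡⟨ ar₁ (#components T′) (#faces T) ⟩
      4 * #components T′ + 2 * (#faces T + 1)      ≤⟨ +-mono-≤ (*-monoʳ-≤ 4 c≤) (*-monoʳ-≤ 2 z<) ⟩
      4 * (#components T + 1) + 2 * #faces T′      ≡⟨ ar₂ (#components T) (#faces T′) ⟩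
      4 * #components T + 2 * #faces T′ + 2 + 2    ∎)
      where
      open ≤-Reasoning
      ar₁ : ∀ c z → 4 * c + 2 * z + 2 ≡ 4 * c + 2 * (z + 1)
      ar₁ = solve-∀
      ar₂ : ∀ c z → 4 * (c + 1) + 2 * z ≡ 4 * c + 2 * z + 2 + 2
      ar₂ = solve-∀
      c≤ : #components T′ ≤ #components T + 1
      c≤ = ≤-trans (classes-merge-≤ _ (component T′) (Vertices.cls-idem T′) a b) (+-monoˡ-≤ 1
        (classes-antitone _ (component T) (Vertices.cls-idem T) _ (λ _ _ → refl)
          (coarser (merge (component T′) a b) (merge-glues (component T′) a b)
            (λ u v q → merge-cong (component T′) a b (component-edge T′ q)))))
      -- The sources of the darts along an orbit never leave their component of `T′`, so darts with
      -- sources in different components have different orbits.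
      source-inv : ∀ x → component T′ (proj₁ x) ≡ component T′ (proj₁ (ψ T′ x))
      source-inv x with bool-cases (T′ x)
      ... | inj₁ q = trans (component-edge T′ q) (cong (component T′ ∘ proj₁) (sym (ψ-in T′ q)))
      ... | inj₂ q = cong (component T′ ∘ proj₁) (sym (ψ-out T′ q))
      z< : #faces T + 1 ≤ #faces T′
      z< = Tr.orbits-< (ψ-injective remove-isSubgraph) (⊆-darts S e Tab)
        (λ q → ¬p (Orbits.cls-ker T′ (component T′ ∘ proj₁) source-inv e e′ q))

  #isolated : (Dart n → Bool) → ℕ
  #isolated T = count λ u → allFinB λ v → not (T (u , v))

  -- Twice the inequality 2c + m ≤ n + f, `count T` being twice the number of edges. A vertex
  -- isolated in `G` is the source of no dart and so has no orbit; its face is supplied by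
  -- `#isolated isDart`.
  Euler : (Dart n → Bool) → Set
  Euler T = 4 * #components T + count T ≤ 2 * n + 2 * #faces T + 2 * #isolated isDart

  remove-Euler : ∀ {T} → IsSubgraph T → ∀ a b → T (a , b) ≡ true → Euler T → Euler (remove (a , b) T)
  remove-Euler {T} S a b Tab E = +-cancelʳ-≤ (4 * c + 2 * z + 2) _ _ (begin
      4 * c′ + M′ + (4 * c + 2 * z + 2)              ≡⟨ ar₁ c′ M′ c z ⟩
      (4 * c′ + 2 * z) + (4 * c + (M′ + 2))
        ≤⟨ +-mono-≤ components-faces (≤-trans (≤-reflexive (cong (4 * c +_) (sym count-remove))) E) ⟩
      (4 * c + 2 * z′ + 2) + (2 * n + 2 * z + 2 * i) ≡⟨ ar₂ c z z′ n i ⟩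
      2 * n + 2 * z′ + 2 * i + (4 * c + 2 * z + 2)   ∎)
    where
    open ≤-Reasoning
    open Removal S a b Tab
    T′ = remove (a , b) T
    c  = #components T
    c′ = #components T′
    z  = #faces T
    z′ = #faces T′
    M′ = count T′
    i  = #isolated isDart
    ar₁ : ∀ c′ M′ c z → 4 * c′ + M′ + (4 * c + 2 * z + 2) ≡ (4 * c′ + 2 * z) + (4 * c + (M′ + 2))
    ar₁ = solve-∀
    ar₂ : ∀ c z z′ n i → (4 * c + 2 * z′ + 2) + (2 * n + 2 * z + 2 * i) ≡ 2 * n + 2 * z′ + 2 * i + (4 * c + 2 * z + 2)
    ar₂ = solve-∀

-- From the definition of planarity to the Euler inequality for subgraphs

<ᵇ-complete : ∀ {a b} → a < b → (a <ᵇ b) ≡ true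
<ᵇ-complete p = Equivalence.to T-≡ (<⇒<ᵇ p)

<ᵇ-sound : ∀ {a b} → (a <ᵇ b) ≡ true → a < b
<ᵇ-sound {a} {b} p = <ᵇ⇒< a b (Equivalence.from T-≡ p)

allFinB-intro : ∀ {n} (p : Fin n → Bool) → (∀ i → p i ≡ true) → allFinB p ≡ true
allFinB-intro {zero}  p h = refl
allFinB-intro {suc n} p h = ∧-intro (h fz) (allFinB-intro (p ∘ fs) (h ∘ fs))

allFinB-elim : ∀ {n} (p : Fin n → Bool) → allFinB p ≡ true → ∀ i → p i ≡ true
allFinB-elim p h fz     = proj₁ (∧-true h)
allFinB-elim p h (fs i) = allFinB-elim (p ∘ fs) (proj₂ (∧-true {p fz} h)) i

anyFinB-elim : ∀ {n} (p : Fin n → Bool) → anyFinB p ≡ true → ∃[ i ] p i ≡ true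
anyFinB-elim {suc n} p h with ∨-true {p fz} h
... | inj₁ q = fz , q
... | inj₂ q = let (i , r) = anyFinB-elim (p ∘ fs) q in fs i , r

least : ∀ {n} (p : Fin n → Bool) {v} → p v ≡ true →
  ∃[ w ] (p w ≡ true × ∀ u → toℕ u < toℕ w → p u ≡ false)
least {suc n} p {v} pv with bool-cases (p fz)
... | inj₁ p0 = fz , p0 , λ _ ()
least {suc n} p {fz}   pv | inj₂ p0 = ⊥-bool pv p0
least {suc n} p {fs v} pv | inj₂ p0 with least (p ∘ fs) pv
... | w , pw , min = fs w , pw , λ where
  fz     _ → p0
  (fs u) h → min u (s≤s⁻¹ h)

not-true : ∀ {b} → not b ≡ true → b ≡ false
not-true {false} _ = refl

not-false : ∀ {b} → b ≡ false → not b ≡ true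
not-false refl = refl

∑∑-count : ∀ {n} (p : Fin n → Fin n → Bool) →
  sumFin (λ i → countFin (p i)) ≡ count (λ ((i , j) : Dart n) → p i j)
∑∑-count p = trans (sym (∑-Fin _)) (trans (∑-cong (λ i → count-Fin (p i))) (sym (∑-× _)))

handshake : ∀ {n} (G : Graph n) → count (λ (x : Dart n) → adj G (proj₁ x) (proj₂ x)) ≡ 2 * edges G
handshake {n} G = sym (begin
  2 * edges G                          ≡⟨ cong (λ t → t + (t + 0)) (∑∑-count up) ⟩
  U + (U + 0)                          ≡⟨ cong (U +_) (+-identityʳ U) ⟩
  U + U                                ≡⟨ cong (U +_) (trans (∑-× _) (trans (∑-swap _) (sym (∑-× _)))) ⟩
  U + (∑[ x ] 𝟙 (up (proj₂ x) (proj₁ x))) ≡⟨ ∑-+ _ _ ⟨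
  ∑[ x ] (𝟙 (up (proj₁ x) (proj₂ x)) + 𝟙 (up (proj₂ x) (proj₁ x))) ≡⟨ ∑-cong (λ (i , j) → pt i j) ⟩
  count (λ x → adj G (proj₁ x) (proj₂ x)) ∎)
  where
  open ≡-Reasoning
  up : Fin n → Fin n → Bool
  up i j = (toℕ i <ᵇ toℕ j) ∧ adj G i j
  U = count (λ (x : Dart n) → up (proj₁ x) (proj₂ x))
  ≮ᵇ : ∀ {a b} → ¬ a < b → (a <ᵇ b) ≡ false
  ≮ᵇ p = ≢true (p ∘ <ᵇ-sound)
  pt : ∀ i j → 𝟙 (up i j) + 𝟙 (up j i) ≡ 𝟙 (adj G i j)
  pt i j with <-cmp (toℕ i) (toℕ j)
  ... | tri< p _ q rewrite <ᵇ-complete p | ≮ᵇ q = +-identityʳ _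
  ... | tri> p _ q rewrite <ᵇ-complete q | ≮ᵇ p = cong 𝟙 (adj-sym G j i)
  ... | tri≈ p e q rewrite ≮ᵇ p | ≮ᵇ q with Fin.toℕ-injective e
  ...   | refl rewrite adj-irrefl G i = refl

code-injective : ∀ {n} {x y : Dart n} → code x ≡ code y → x ≡ y
code-injective {n} {u , v} {u′ , v′} e =
  let (p , q) = Fin.combine-injective u v u′ v′ (Fin.toℕ-injective (trans (c u v) (trans e (sym (c u′ v′)))))
  in cong₂ _,_ p q
  where
  c : ∀ (u v : Fin n) → toℕ (combine u v) ≡ toℕ u * n + toℕ v
  c u v = trans (Fin.toℕ-combine u v) (cong (_+ toℕ v) (*-comm n (toℕ u)))

-- A copy of the recursion local to `orbitMin`, identified with it below in the same way as `succIn`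
-- with that of `nextIn`.
minUpTo : ∀ {n} {G : Graph n} → Rotation G → Dart n → ℕ → Bool
minUpTo R d zero    = true
minUpTo R d (suc k) = (code d ≤ᵇ code (iter k (faceStep R) d)) ∧ minUpTo R d k

minUpTo-unique : ∀ {n} {G : Graph n} (R : Rotation G) (d : Dart n) (g : ℕ → Bool) → g 0 ≡ true →
  (∀ k → g (suc k) ≡ ((code d ≤ᵇ code (iter k (faceStep R) d)) ∧ g k)) → ∀ k → g k ≡ minUpTo R d k
minUpTo-unique R d g a b zero    = a
minUpTo-unique R d g a b (suc k) = trans (b k)
  (cong (λ t → (code d ≤ᵇ code (iter k (faceStep R) d)) ∧ t) (minUpTo-unique R d g a b k))

mutual
  private
    orbitMin-local : ∀ {n} {G : Graph n} → Rotation G → Dart n → ℕ → Bool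
    orbitMin-local = _

  orbitMin≡minUpTo : ∀ {n} {G : Graph n} (R : Rotation G) (d : Dart n) → orbitMin R d ≡ minUpTo R d (n * n)
  orbitMin≡minUpTo {n} R d with n * n
  ... | k = minUpTo-unique R d (orbitMin-local R d) refl (λ _ → refl) k

orbitMin-least : ∀ {n} {G : Graph n} (R : Rotation G) d → orbitMin R d ≡ true →
  ∀ {k} → k < n * n → code d ≤ code (iter k (faceStep R) d)
orbitMin-least {n} R d h = go (n * n) (trans (sym (orbitMin≡minUpTo R d)) h)
  where
  go : ∀ j → minUpTo R d j ≡ true → ∀ {k} → k < j → code d ≤ code (iter k (faceStep R) d)
  go (suc j) p {k} k<j with m≤n⇒m<n∨m≡n (s≤s⁻¹ k<j)
  ... | inj₁ q    = go j (proj₂ (∧-true {code d ≤ᵇ code (iter j (faceStep R) d)} p)) q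
  ... | inj₂ refl = ≤ᵇ⇒≤ _ _ (Equivalence.from T-≡ (proj₁ (∧-true p)))

module _ {n} (G : Graph n) (R : Rotation G) where
  open Embedding G R

  private
    reach-component : ∀ k {u v} → reach G k u v ≡ true → component isDart u ≡ component isDart v
    reach-component zero    p = cong (component isDart) (≡ᵇ-sound p)
    reach-component (suc k) {u} {v} p with ∨-true {reach G k u v} p
    ... | inj₁ q = reach-component k q
    ... | inj₂ q with anyFinB-elim (λ w → reach G k u w ∧ adj G w v) q
    ...   | w , r = let (r₁ , r₂) = ∧-true r in
              trans (reach-component k r₁) (component-edge isDart r₂)

  -- Send each root to the least vertex of its component. Whatever `reach` finds lies in the same
  -- component, so no smaller vertex is reached and this one is counted by `components`.
  #components≤components : #components isDart ≤ components G
  #components≤components = ≤-trans (count-injection _ minimal first first-minimal first-injective)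
    (≤-reflexive (sym (count-Fin minimal)))
    where
    minimal : Fin n → Bool
    minimal v = allFinB λ u → not ((toℕ u <ᵇ toℕ v) ∧ reach G n u v)
    find : ∀ v → _
    find v = least (λ w → component isDart w ≡ᵇ component isDart v) {v} (≡ᵇ-complete refl)
    first : Fin n → Fin n
    first v = proj₁ (find v)
    first-component : ∀ v → component isDart (first v) ≡ component isDart v
    first-component v = ≡ᵇ-sound (proj₁ (proj₂ (find v)))
    first-minimal : ∀ v → _ → minimal (first v) ≡ true
    first-minimal v _ = allFinB-intro _ λ u → not-false (≢true λ p →
      let (u< , re) = ∧-true p in
      ⊥-bool (≡ᵇ-complete (trans (reach-component n re) (first-component v)))
             (proj₂ (proj₂ (find v)) u (<ᵇ-sound u<)))
    first-injective : ∀ v w → (component isDart v ≡ᵇ v) ≡ true → (component isDart w ≡ᵇ w) ≡ true →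
      first v ≡ first w → v ≡ w
    first-injective v w p q e = trans (sym (≡ᵇ-sound p)) (trans (sym (first-component v))
      (trans (cong (component isDart) e) (trans (first-component w) (≡ᵇ-sound q))))

  -- On darts of `G`, `ψ isDart` is `faceStep`. Two minimal darts of one orbit reach each other,
  -- within `n * n` steps by `iter-bounded`, so each code is at most the other and the darts agree.
  faces≤#faces : faces R ≤ #faces isDart
  faces≤#faces = ≤-trans (≤-reflexive (∑∑-count _)) (count-injection _ _ (face isDart)
    (λ x p → ∧-intro (trans (Orbits.cls-invariant isDart isDart (sym ∘ ψ-isDart isDart) x) (proj₁ (∧-true p)))
                     (≡ᵇ-complete (Orbits.cls-idem isDart x)))
    λ x y p q e → let (dx , mx) = ∧-true p; (dy , my) = ∧-true q in code-injective
      (≤-antisym (below x y dx mx e) (below y x dy my (sym e))))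
    where
    ψ-inj : ∀ {x y} → ψ isDart x ≡ ψ isDart y → x ≡ y
    ψ-inj = ψ-injective darts-isSubgraph
    module E = IsEquivalence (reaches-isEquivalence ψ-inj)
    iter-ψ-isDart : ∀ k x → isDart (iter k (ψ isDart) x) ≡ isDart x
    iter-ψ-isDart zero    x = refl
    iter-ψ-isDart (suc k) x = trans (ψ-isDart isDart _) (iter-ψ-isDart k x)
    iter-ψ : ∀ k x → isDart x ≡ true → iter k (ψ isDart) x ≡ iter k (faceStep R) x
    iter-ψ zero    x p = refl
    iter-ψ (suc k) x p = trans (ψ-in isDart (trans (iter-ψ-isDart k x) p)) (cong (faceStep R) (iter-ψ k x p))
    below : ∀ x y → isDart x ≡ true → orbitMin R x ≡ true → face isDart x ≡ face isDart y → code x ≤ code y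
    below x y dx mx e
      with E.trans (E.sym (lst x)) (E.trans (E.reflexive e) (lst y))
      where lst = Orbits.cls-least isDart (reaches-isEquivalence ψ-inj) (λ i → 1 , refl)
    ... | k , refl with iter-bounded ψ-inj k x
    ...   | j , j< , eq = ≤-trans (orbitMin-least R x mx j<)
                            (≤-reflexive (cong code (trans (sym (iter-ψ j x dx)) eq)))

  planar⇒Euler : n + faces R + isolated G ≡ 2 * components G + edges G → Euler isDart
  planar⇒Euler eq = begin
    4 * #components isDart + count isDart
      ≤⟨ +-mono-≤ (*-monoʳ-≤ 4 #components≤components) (≤-reflexive (handshake G)) ⟩
    4 * components G + 2 * edges G           ≡⟨ ar₁ (components G) (edges G) ⟩
    2 * (2 * components G + edges G)         ≡⟨ cong (2 *_) eq ⟨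
    2 * (n + faces R + isolated G)
      ≤⟨ *-monoʳ-≤ 2 (+-mono-≤ (+-monoʳ-≤ n faces≤#faces) (≤-reflexive (count-Fin _))) ⟩
    2 * (n + #faces isDart + #isolated isDart) ≡⟨ ar₂ n (#faces isDart) (#isolated isDart) ⟩
    2 * n + 2 * #faces isDart + 2 * #isolated isDart ∎
    where
    open ≤-Reasoning
    ar₁ : ∀ c m → 4 * c + 2 * m ≡ 2 * (2 * c + m)
    ar₁ = solve-∀
    ar₂ : ∀ n z i → 2 * (n + z + i) ≡ 2 * n + 2 * z + 2 * i
    ar₂ = solve-∀

  -- Edges outside `S` are deleted until none is left; `k` bounds the number of remaining darts,
  -- which falls with each deletion. The outcome agrees with `S` pointwise.
  Euler-subgraph : Euler isDart → ∀ {S} → IsSubgraph S →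
    ∃[ T ] (IsSubgraph T × Euler T × ∀ x → T x ≡ S x)
  Euler-subgraph E {S} sub = shrink (count isDart) isDart darts-isSubgraph E (IsSubgraph.⊆-darts sub) ≤-refl
    where
    shrink : ∀ k T → IsSubgraph T → Euler T → (∀ x → S x ≡ true → T x ≡ true) → count T ≤ k →
      ∃[ T ] (IsSubgraph T × Euler T × ∀ x → T x ≡ S x)
    shrink k T sT E S⊆T c with findᵇ (λ x → T x ∧ not (S x))
    ... | inj₂ none = T , sT , E , λ x → true⇔⇒≡ (λ p → bool (S x) (λ q → ⊥-bool (∧-intro p q) (none x))) (S⊆T x)
      where
      bool : ∀ b → (not b ≡ true → b ≡ true) → b ≡ true
      bool true  _ = refl
      bool false h = h refl
    shrink zero T sT E S⊆T c | inj₁ (x , p) =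
      ⊥-elim (1+n≰n (≤-trans (≤-reflexive (cong 𝟙 (sym (proj₁ (∧-true p))))) (≤-trans (∑-term (𝟙 ∘ T) x) c)))
    shrink (suc k) T sT E S⊆T c | inj₁ ((a , b) , p) =
      shrink k (remove (a , b) T) (remove-isSubgraph sT a b Tab) (remove-Euler sT a b Tab E) S⊆ c′
      where
      Tab = proj₁ (∧-true p)
      Sab : S (a , b) ≡ false
      Sab = not-true (proj₂ (∧-true {T (a , b)} p))
      open Removal using (remove-isSubgraph; count-remove)
      S⊆ : ∀ x → S x ≡ true → remove (a , b) T x ≡ true
      S⊆ x q = ∧-intro (S⊆T x q) (not-false (≢true λ r → case (∨-true r)))
        where
        case : ((a , b) ≡ᵇ x) ≡ true ⊎ (swap (a , b) ≡ᵇ x) ≡ true → ⊥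
        case (inj₁ e) with ≡ᵇ-sound e
        ... | refl = ⊥-bool q Sab
        case (inj₂ e) with ≡ᵇ-sound e
        ... | refl = ⊥-bool (trans (IsSubgraph.symmetric sub (b , a)) q) Sab
      c′ : count (remove (a , b) T) ≤ k
      c′ = s≤s⁻¹ (≤-trans (≤-trans (≤-reflexive (+-comm 1 _)) (+-monoʳ-≤ _ (s≤s z≤n)))
             (≤-trans (≤-reflexive (sym (count-remove sT a b Tab))) c))

-- Sparsity: face lengths and the edge bound

count-≥3 : {{_ : Finite A}} (p : A → Bool) {x y z : A} → p x ≡ true → p y ≡ true → p z ≡ true →
  ¬ x ≡ y → ¬ y ≡ z → ¬ x ≡ z → 3 ≤ count p
count-≥3 p {x} {y} {z} px py pz x≢y y≢z x≢z = begin
  3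
    ≡⟨ cong₂ _+_ (count-≡ᵇ x) (cong₂ _+_ (count-≡ᵇ y) (count-≡ᵇ z)) ⟨
  count (x ≡ᵇ_) + (count (y ≡ᵇ_) + count (z ≡ᵇ_))             ≡⟨ cong (count (x ≡ᵇ_) +_) (∑-+ _ _) ⟨
  count (x ≡ᵇ_) + (∑[ t ] (𝟙 (y ≡ᵇ t) + 𝟙 (z ≡ᵇ t)))          ≡⟨ ∑-+ _ _ ⟨
  ∑[ t ] (𝟙 (x ≡ᵇ t) + (𝟙 (y ≡ᵇ t) + 𝟙 (z ≡ᵇ t)))             ≤⟨ ∑-mono pt ⟩
  count p                                                     ∎
  where
  open ≤-Reasoning
  pt : ∀ t → 𝟙 (x ≡ᵇ t) + (𝟙 (y ≡ᵇ t) + 𝟙 (z ≡ᵇ t)) ≤ 𝟙 (p t)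
  pt t with x ≟ t | y ≟ t | z ≟ t
  ... | yes e | yes f | _     = ⊥-elim (x≢y (trans e (sym f)))
  ... | yes e | _     | yes f = ⊥-elim (x≢z (trans e (sym f)))
  ... | _     | yes e | yes f = ⊥-elim (y≢z (trans e (sym f)))
  ... | yes refl | no _ | no _ = ≤-reflexive (sym (cong 𝟙 px))
  ... | no _ | yes refl | no _ = ≤-reflexive (sym (cong 𝟙 py))
  ... | no _ | no _ | yes refl = ≤-reflexive (sym (cong 𝟙 pz))
  ... | no _ | no _ | no _ = z≤n

module Sparsity {n} (G : Graph n) (R : Rotation G) where
  open Embedding G R

  lonely : (Dart n → Bool) → Fin n → Bool
  lonely T u = allFinB λ v → not (T (u , v))

  lonely-elim : ∀ T {u v} → lonely T u ≡ true → T (u , v) ≡ false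
  lonely-elim T {u} {v} h = not-true (allFinB-elim (λ v → not (T (u , v))) h v)

  lonely-intro : ∀ T {u} → (∀ v → T (u , v) ≡ false) → lonely T u ≡ true
  lonely-intro T {u} h = allFinB-intro (λ v → not (T (u , v))) (not-false ∘ h)

  neighbour : ∀ T {u} → lonely T u ≡ false → ∃[ v ] T (u , v) ≡ true
  neighbour T {u} h with findᵇ (λ v → T (u , v))
  ... | inj₁ p    = p
  ... | inj₂ none = ⊥-bool (lonely-intro T none) h

  -- Excludes components that consist of a single edge, whose face has only two darts.
  Branching : (Dart n → Bool) → Set
  Branching T = ∀ a b → T (a , b) ≡ true →
    (∃[ c ] (T (b , c) ≡ true × ¬ c ≡ a)) ⊎ (∃[ c ] (T (a , c) ≡ true × ¬ c ≡ b))

  module _ {T} (S : IsSubgraph T) where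
    open IsSubgraph S

    private
      T-swap : ∀ {u v} → T (u , v) ≡ true → T (v , u) ≡ true
      T-swap {u} {v} p = trans (symmetric (u , v)) p

      edge-not-lonely : ∀ {u v} → T (u , v) ≡ true → lonely T u ≡ false
      edge-not-lonely p = ≢true (λ l → ⊥-bool p (lonely-elim T l))

    -- Every isolated vertex is the root of its own component, and the component of `u` has yet
    -- another root, since it contains an edge.
    lonely<components : ∀ {u v} → T (u , v) ≡ true → #isolated T + 1 ≤ #components T
    lonely<components {u} {v} Tuv = begin
      #isolated T + 1                                       ≡⟨ cong (#isolated T +_) (count-≡ᵇ r) ⟨
      #isolated T + count (r ≡ᵇ_)                           ≡⟨ ∑-+ _ _ ⟨
      ∑[ w ] (𝟙 (lonely T w) + 𝟙 (r ≡ᵇ w))                  ≤⟨ ∑-mono pt ⟩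
      #components T                                         ∎
      where
      open ≤-Reasoning
      r = component T u
      r-not-lonely : lonely T r ≡ false
      r-not-lonely = trans (component-invariant T (lonely T)
        (λ a b p → trans (edge-not-lonely p) (sym (edge-not-lonely (T-swap p)))) u) (edge-not-lonely Tuv)
      -- Being equal to `w` is invariant along edges because none touches `w`; hence the root of `w`
      -- is `w`.
      lonely-root : ∀ w → lonely T w ≡ true → component T w ≡ w
      lonely-root w l = sym (≡ᵇ-sound (trans (component-invariant T (w ≡ᵇ_) inv w) (≡ᵇ-complete refl)))
        where
        inv : ∀ a b → T (a , b) ≡ true → (w ≡ᵇ a) ≡ (w ≡ᵇ b)
        inv a b p = trans
          (≡ᵇ-refute {x = w} {y = a} λ { refl → ⊥-bool p (lonely-elim T l) })
          (sym (≡ᵇ-refute {x = w} {y = b} λ { refl → ⊥-bool (T-swap p) (lonely-elim T l) }))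
      pt : ∀ w → 𝟙 (lonely T w) + 𝟙 (r ≡ᵇ w) ≤ 𝟙 (component T w ≡ᵇ w)
      pt w with r ≟ w
      ... | yes refl rewrite r-not-lonely | ≡ᵇ-complete (Vertices.cls-idem T u) = ≤-refl
      ... | no _ = ≤-trans (≤-reflexive (+-identityʳ _)) (𝟙-mono (≡ᵇ-complete ∘ lonely-root w))

    private
      _~_ : Dart n → Dart n → Set
      x ~ y = face T x ≡ face T y

      ~-in : ∀ {a b} → T (a , b) ≡ true → (a , b) ~ (b , next b a)
      ~-in p = trans (Orbits.cls-gen T _) (cong (face T) (ψ-in T p))

      ~-out : ∀ {a b} → T (a , b) ≡ false → (a , b) ~ (a , next a b)
      ~-out p = trans (Orbits.cls-gen T _) (cong (face T) (ψ-out T p))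

    -- At a marker outside `T`, `ψ T` merely rotates about `b`. The orbit therefore turns through
    -- the neighbours of `b` until it hits a dart of `T`, at the latest `(b , x)`.
    face-meets-T : ∀ {b w x} → adj G b w ≡ true → T (b , x) ≡ true →
      ∃[ c ] (T (b , c) ≡ true × (b , w) ~ (b , c))
    face-meets-T {b} {w} {x} bw bx with next-transitive b Q step bw (inj₂ refl) (⊆-darts _ bx)
      where
      Q : Fin n → Set
      Q y = (∃[ c ] (T (b , c) ≡ true × (b , w) ~ (b , c))) ⊎ ((b , w) ~ (b , y))
      step : ∀ y → adj G b y ≡ true → Q y → Q (next b y)
      step y _ (inj₁ f) = inj₁ f
      step y _ (inj₂ s) with bool-cases (T (b , y))
      ... | inj₁ p = inj₁ (y , p , s)
      ... | inj₂ p = inj₂ (trans s (~-out p))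
    ... | inj₁ f = f
    ... | inj₂ s = x , bx , s

    face-continues : ∀ {a b} → T (a , b) ≡ true → ∃[ c ] (T (b , c) ≡ true × (a , b) ~ (b , c))
    face-continues {a} {b} ab =
      let (c , p , s) = face-meets-T (trans (next-adj b a) (⊆-darts _ (T-swap ab))) (T-swap ab)
      in c , p , trans (~-in ab) s

    -- After arriving from `a`, the face rotates about `b` starting just past `a`. It cannot come
    -- back round to `a` without meeting `c′` or an earlier dart of `T`.
    face-turns : ∀ {a b c′} → T (a , b) ≡ true → T (b , c′) ≡ true → ¬ c′ ≡ a →
      ∃[ c ] (T (b , c) ≡ true × ¬ c ≡ a × (a , b) ~ (b , c))
    face-turns {a} {b} {c′} ab bc′ c′≢a
      with next-transitive b Q step (⊆-darts _ (T-swap ab)) (inj₂ (~-in ab , inj₁ refl)) (⊆-darts _ bc′)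
      where
      Q : Fin n → Set
      Q y = (∃[ c ] (T (b , c) ≡ true × ¬ c ≡ a × (a , b) ~ (b , c)))
          ⊎ ((a , b) ~ (b , next b y) × (y ≡ a ⊎ T (b , y) ≡ false))
      step : ∀ y → adj G b y ≡ true → Q y → Q (next b y)
      step y _ (inj₁ f) = inj₁ f
      step y _ (inj₂ (s , _)) with next b y ≟ a | bool-cases (T (b , next b y))
      -- A full turn back to `a` just restarts the search. The invariant speaks of the dart after
      -- `y`, so at `y = c′` it would assert that `c′` is `a` or outside `T`.
      ... | yes e | _      = inj₂ (trans (~-in ab) (cong (λ t → face T (b , next b t)) (sym e)) , inj₁ e)
      ... | no ¬e | inj₁ p = inj₁ (next b y , p , ¬e , s)
      ... | no ¬e | inj₂ p = inj₂ (trans s (~-out p) , inj₂ p)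
    ... | inj₁ f            = f
    ... | inj₂ (_ , inj₁ e) = ⊥-elim (c′≢a e)
    ... | inj₂ (_ , inj₂ p) = ⊥-bool bc′ p

    -- A face that can go on at `b` without turning back has a third dart after `(b , c)`. If it
    -- does turn back at `b`, the edge branches at `a`, and the face leaves `a` along a dart other
    -- than `(a , b)`.
    three-darts : Branching T → ∀ {a b} → T (a , b) ≡ true →
      3 ≤ count (λ x → T x ∧ (face T x ≡ᵇ face T (a , b)))
    three-darts br {a} {b} ab with br a b ab
    ... | inj₁ (_ , bc′ , c′≢a) =
      let (c , bc , c≢a , s) = face-turns ab bc′ c′≢a
          (d , cd , s′)      = face-continues bc
      in count-≥3 _ {a , b} {b , c} {c , d}
           (∧-intro ab (≡ᵇ-complete refl)) (∧-intro bc (≡ᵇ-complete (sym s)))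
           (∧-intro cd (≡ᵇ-complete (sym (trans s s′))))
           (irreflexive ab ∘ cong proj₁) (irreflexive bc ∘ cong proj₁) (c≢a ∘ sym ∘ cong proj₁)
    ... | inj₂ (_ , ac′ , c′≢b) with face-continues ab
    ...   | c , bc , s with c ≟ a
    ...     | no c≢a =
      let (d , cd , s′) = face-continues bc
      in count-≥3 _ {a , b} {b , c} {c , d}
           (∧-intro ab (≡ᵇ-complete refl)) (∧-intro bc (≡ᵇ-complete (sym s)))
           (∧-intro cd (≡ᵇ-complete (sym (trans s s′))))
           (irreflexive ab ∘ cong proj₁) (irreflexive bc ∘ cong proj₁) (c≢a ∘ sym ∘ cong proj₁)
    ...     | yes refl =
      let (d , ad , d≢b , s′) = face-turns bc ac′ c′≢b
      in count-≥3 _ {a , b} {b , a} {a , d}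
           (∧-intro ab (≡ᵇ-complete refl)) (∧-intro bc (≡ᵇ-complete (sym s)))
           (∧-intro ad (≡ᵇ-complete (sym (trans s s′))))
           (irreflexive ab ∘ cong proj₁) (irreflexive bc ∘ cong proj₁) (d≢b ∘ sym ∘ cong proj₂)

    -- A busy orbit, whose root starts at a vertex with an edge of `T`, contains a dart of `T` and
    -- hence three. A quiet orbit consists of all darts of `G` at a vertex isolated in `T`, so there
    -- is at most one for each vertex isolated in `T` but not in `G`.
    faces-bound : Branching T → 3 * #faces T + 3 * #isolated isDart ≤ count T + 3 * #isolated T
    faces-bound br = begin
      3 * #faces T + 3 * #isolated isDart            ≡⟨ cong (λ t → 3 * t + 3 * #isolated isDart) split ⟩
      3 * (count quiet + count busy) + 3 * #isolated isDart
        ≡⟨ ar (count quiet) (count busy) (#isolated isDart) ⟩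
      3 * count busy + 3 * (#isolated isDart + count quiet)
        ≤⟨ +-mono-≤ busy≤ (*-monoʳ-≤ 3 (+-monoʳ-≤ (#isolated isDart) quiet≤)) ⟩
      count T + 3 * (#isolated isDart + count newly)
        ≡⟨ cong (λ t → count T + 3 * t) (count-compl (lonely T) (lonely isDart) lonely-mono) ⟩
      count T + 3 * #isolated T                      ∎
      where
      open ≤-Reasoning
      ar : ∀ l b i → 3 * (l + b) + 3 * i ≡ 3 * b + 3 * (i + l)
      ar = solve-∀
      root quiet busy : Dart n → Bool
      root y = isDart y ∧ (face T y ≡ᵇ y)
      quiet y = root y ∧ lonely T (proj₁ y)
      busy y = root y ∧ not (quiet y)
      newly : Fin n → Bool
      newly u = lonely T u ∧ not (lonely isDart u)
      split : #faces T ≡ count quiet + count busy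
      split = sym (count-compl root quiet (λ y → proj₁ ∘ ∧-true))
      lonely-mono : ∀ u → lonely isDart u ≡ true → lonely T u ≡ true
      lonely-mono u l = lonely-intro T λ v → ≢true λ p → ⊥-bool (⊆-darts (u , v) p) (lonely-elim isDart l)
      quiet-elim : ∀ u v → quiet (u , v) ≡ true → adj G u v ≡ true × face T (u , v) ≡ (u , v) × lonely T u ≡ true
      quiet-elim u v p = let (q , l) = ∧-true p; (d , r) = ∧-true q in d , ≡ᵇ-sound r , l
      quiet≤ : count quiet ≤ count newly
      quiet≤ = count-injection quiet newly proj₁
        (λ (u , v) p → let (d , r , l) = quiet-elim u v p in
           ∧-intro l (not-false (≢true λ l′ → ⊥-bool d (lonely-elim isDart l′))))
        (λ where
          (u , v) (u′ , v′) p p′ refl → let (d , r , l) = quiet-elim u v p; (d′ , r′ , _) = quiet-elim u v′ p′ in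
            trans (sym r) (trans (next-transitive u (λ y → (u , v) ~ (u , y))
              (λ w _ s → trans s (~-out (lonely-elim T l))) d refl d′) r′))
      busy≤ : 3 * count busy ≤ count T
      busy≤ = begin
        3 * count busy                                       ≡⟨ ∑-* 3 _ ⟨
        ∑[ y ] (3 * 𝟙 (busy y))                              ≤⟨ ∑-mono pt ⟩
        ∑[ y ] count (λ x → T x ∧ (face T x ≡ᵇ y))        ≡⟨ ∑-fibres T (face T) ⟨
        count T                                           ∎
        where
        pt : ∀ y → 3 * 𝟙 (busy y) ≤ count (λ x → T x ∧ (face T x ≡ᵇ y))
        pt (u , v) with bool-cases (busy (u , v))
        ... | inj₂ p rewrite p = z≤n
        ... | inj₁ p with ∧-true p
        ...   | q , q′ with ∧-true q
        ...     | d , r with neighbour T {u} (≢true λ l → ⊥-bool (∧-intro q l) (not-true q′))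
        ...       | x , ux with face-meets-T d ux
        ...         | c , uc , s rewrite p =
          subst (λ y → 3 ≤ count (λ x → T x ∧ (face T x ≡ᵇ y))) (trans (sym s) (≡ᵇ-sound r))
            (three-darts br uc)

    -- Three times `Euler` plus twice `faces-bound` eliminates the faces. The 12 is 3 · 4 times the
    -- one component that `lonely<components` finds besides the isolated vertices.
    sparse : Euler T → Branching T → ∀ {u v} → T (u , v) ≡ true →
      count T + 12 ≤ 6 * count (not ∘ lonely T)
    sparse E br uv = +-cancelʳ-≤ (12 * i + 2 * M + 6 * z + 6 * g) _ _ (begin
        M + 12 + (12 * i + 2 * M + 6 * z + 6 * g)          ≡⟨ ar₁ M i z g ⟩
        3 * (4 * (i + 1) + M) + 2 * (3 * z + 3 * g)
          ≤⟨ +-mono-≤ (*-monoʳ-≤ 3 (+-monoˡ-≤ M (*-monoʳ-≤ 4 (lonely<components uv)))) (*-monoʳ-≤ 2 (faces-bound br)) ⟩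
        3 * (4 * #components T + M) + 2 * (M + 3 * i)      ≤⟨ +-monoˡ-≤ _ (*-monoʳ-≤ 3 E) ⟩
        3 * (2 * n + 2 * z + 2 * g) + 2 * (M + 3 * i)
          ≡⟨ cong (λ t → 3 * (2 * t + 2 * z + 2 * g) + 2 * (M + 3 * i)) total ⟨
        3 * (2 * (i + k) + 2 * z + 2 * g) + 2 * (M + 3 * i) ≡⟨ ar₂ M i z g k ⟩
        6 * k + (12 * i + 2 * M + 6 * z + 6 * g)           ∎)
      where
      open ≤-Reasoning
      i = #isolated T
      M = count T
      z = #faces T
      g = #isolated isDart
      k = count (not ∘ lonely T)
      total : i + k ≡ n
      total = trans (count-compl (λ _ → true) (lonely T) (λ _ _ → refl)) (count-all n)
      ar₁ : ∀ M i z g → M + 12 + (12 * i + 2 * M + 6 * z + 6 * g) ≡ 3 * (4 * (i + 1) + M) + 2 * (3 * z + 3 * g)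
      ar₁ = solve-∀
      ar₂ : ∀ M i z g k → 3 * (2 * (i + k) + 2 * z + 2 * g) + 2 * (M + 3 * i) ≡ 6 * k + (12 * i + 2 * M + 6 * z + 6 * g)
      ar₂ = solve-∀

  planar-sparse : n + faces R + isolated G ≡ 2 * components G + edges G → ∀ {S} → IsSubgraph S →
    Branching S → ∀ {u v} → S (u , v) ≡ true → count S + 12 ≤ 6 * count (not ∘ lonely S)
  planar-sparse eq {S} sub br uv with Euler-subgraph G R (planar⇒Euler G R eq) sub
  ... | T , subT , E , T≡S = begin
    count S + 12                  ≡⟨ cong (_+ 12) (∑-cong (λ x → cong 𝟙 (T≡S x))) ⟨
    count T + 12                  ≤⟨ sparse subT E brT (trans (T≡S _) uv) ⟩
    6 * count (not ∘ lonely T)    ≤⟨ *-monoʳ-≤ 6 (∑-mono (λ u → 𝟙-mono (λ p → not-false (≢true (λ l → ⊥-bool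
                                       (lonely-intro T (λ v → trans (T≡S (u , v)) (lonely-elim S l))) (not-true p)))))) ⟩
    6 * count (not ∘ lonely S)    ∎
    where
    open ≤-Reasoning
    brT : Branching T
    brT a b ab with br a b (trans (sym (T≡S _)) ab)
    ... | inj₁ (c , p , q) = inj₁ (c , trans (T≡S _) p , q)
    ... | inj₂ (c , p , q) = inj₂ (c , trans (T≡S _) p , q)

-- Counting cliques by size

∑-suc : ∀ {n} (f : Fin (suc n) → ℕ) → ∑ f ≡ f fz + ∑ (f ∘ fs)
∑-suc f = trans (∑-Fin f) (cong (f fz +_) (sym (∑-Fin (f ∘ fs))))

_⁺ : ∀ {n} → (Fin (suc n) → Fin (suc n) → Bool) → Fin n → Fin n → Bool
(A ⁺) i j = A (fs i) (fs j)

_∩_ : ∀ {n} → (Fin n → Bool) → (Fin n → Bool) → Fin n → Bool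
(P ∩ Q) i = P i ∧ Q i

kcliques : ∀ {n} → (Fin n → Fin n → Bool) → (Fin n → Bool) → ℕ → ℕ
kcliques         A P zero    = 1
kcliques {zero}  A P (suc k) = 0
kcliques {suc n} A P (suc k) =
  𝟙 (P fz) * kcliques (A ⁺) ((P ∩ A fz) ∘ fs) k + kcliques (A ⁺) (P ∘ fs) (suc k)

kcliques-cong : ∀ {n} (A : Fin n → Fin n → Bool) {P Q} → (∀ i → P i ≡ Q i) → ∀ k →
  kcliques A P k ≡ kcliques A Q k
kcliques-cong         A h zero    = refl
kcliques-cong {zero}  A h (suc k) = refl
kcliques-cong {suc n} A h (suc k) = cong₂ _+_
  (cong₂ _*_ (cong 𝟙 (h fz)) (kcliques-cong (A ⁺) (λ i → cong (_∧ A fz (fs i)) (h (fs i))) k))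
  (kcliques-cong (A ⁺) (h ∘ fs) (suc k))

𝟙-∧-swap : ∀ p q a k → 𝟙 p * (𝟙 (q ∧ a) * k) ≡ 𝟙 q * (𝟙 (p ∧ a) * k)
𝟙-∧-swap true  true  a k = refl
𝟙-∧-swap true  false a k = refl
𝟙-∧-swap false true  a k = refl
𝟙-∧-swap false false a k = refl

-- Both sides count pairs of a (k+1)-clique in `P` and a marked vertex of it. The induction on `n`
-- splits the pairs by whether vertex 0 is in the clique and whether it is the marked one.
kcliques-double-count : ∀ {n} (A : Fin n → Fin n → Bool) → (∀ i j → A i j ≡ A j i) → (∀ i → A i i ≡ false) →
  ∀ P k → suc k * kcliques A P (suc k) ≡ ∑[ v ] 𝟙 (P v) * kcliques A (P ∩ A v) k
kcliques-double-count {zero}  A A-sym A-irr P k = trans (*-zeroʳ k) (sym (∑-Fin _))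
kcliques-double-count {suc n} A A-sym A-irr P zero = begin
  1 * (𝟙 (P fz) * 1 + kcliques (A ⁺) (P ∘ fs) 1)    ≡⟨ ar (𝟙 (P fz)) _ ⟩
  𝟙 (P fz) * 1 + 1 * kcliques (A ⁺) (P ∘ fs) 1
    ≡⟨ cong (𝟙 (P fz) * 1 +_) (kcliques-double-count (A ⁺) (λ i j → A-sym _ _) (λ i → A-irr _) (P ∘ fs) 0) ⟩
  𝟙 (P fz) * 1 + (∑[ v ] 𝟙 (P (fs v)) * 1)          ≡⟨ ∑-suc _ ⟨
  ∑[ v ] 𝟙 (P v) * 1                                ∎
  where
  open ≡-Reasoning
  ar : ∀ p x → 1 * (p * 1 + x) ≡ p * 1 + 1 * x
  ar = solve-∀
kcliques-double-count {suc n} A A-sym A-irr P (suc k) = begin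
  (2 + k) * (𝟙 (P fz) * X + Y)
    ≡⟨ ar (𝟙 (P fz)) X Y k ⟩
  𝟙 (P fz) * X + (𝟙 (P fz) * (suc k * X) + (2 + k) * Y)
    ≡⟨ cong₂ (λ s t → 𝟙 (P fz) * X + (𝟙 (P fz) * s + t)) (ih ((P ∩ A fz) ∘ fs) k) (ih (P ∘ fs) (suc k)) ⟩
  𝟙 (P fz) * X + (𝟙 (P fz) * ∑ U + ∑ V)
    ≡⟨ cong (λ t → 𝟙 (P fz) * X + (t + ∑ V)) (∑-* (𝟙 (P fz)) U) ⟨
  𝟙 (P fz) * X + ((∑[ v ] 𝟙 (P fz) * U v) + ∑ V)
    ≡⟨ cong (𝟙 (P fz) * X +_) (∑-+ _ V) ⟨
  𝟙 (P fz) * X + (∑[ v ] (𝟙 (P fz) * U v + V v))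
    ≡⟨ cong₂ _+_ (cong (𝟙 (P fz) *_) head) (∑-cong tail) ⟩
  𝟙 (P fz) * kcliques A (P ∩ A fz) (suc k) + (∑[ v ] 𝟙 (P (fs v)) * kcliques A (P ∩ A (fs v)) (suc k))
    ≡⟨ ∑-suc _ ⟨
  ∑[ v ] 𝟙 (P v) * kcliques A (P ∩ A v) (suc k) ∎
  where
  open ≡-Reasoning
  -- Given 0 in `P`, `X` counts the cliques through 0 (marked at 0) and `U v` those through 0 marked
  -- at `v`; `V v` counts the cliques avoiding 0 marked at `v`.
  X = kcliques (A ⁺) ((P ∩ A fz) ∘ fs) (suc k)
  Y = kcliques (A ⁺) (P ∘ fs) (suc (suc k))
  U V : Fin n → ℕ
  U v = 𝟙 (P (fs v) ∧ A fz (fs v)) * kcliques (A ⁺) (((P ∩ A fz) ∘ fs) ∩ (A ⁺) v) k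
  V v = 𝟙 (P (fs v)) * kcliques (A ⁺) ((P ∘ fs) ∩ (A ⁺) v) (suc k)
  ih : ∀ P k → suc k * kcliques (A ⁺) P (suc k) ≡ ∑[ v ] 𝟙 (P v) * kcliques (A ⁺) (P ∩ (A ⁺) v) k
  ih = kcliques-double-count (A ⁺) (λ i j → A-sym _ _) (λ i → A-irr _)
  ar : ∀ p X Y k → (2 + k) * (p * X + Y) ≡ p * X + (p * ((1 + k) * X) + (2 + k) * Y)
  ar = solve-∀
  head : X ≡ kcliques A (P ∩ A fz) (suc k)
  head rewrite A-irr fz | ∧-zeroʳ (P fz) = refl
  shuffle : ∀ p q r → (p ∧ q) ∧ r ≡ (p ∧ r) ∧ q
  shuffle true  q r = ∧-comm q r
  shuffle false q r = refl
  -- A clique through 0 and `v` can be built by choosing either first. With `v` first, the two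
  -- summands are the two branches of `kcliques` on the neighbourhood of `v`.
  tail : ∀ v → 𝟙 (P fz) * U v + V v ≡ 𝟙 (P (fs v)) * kcliques A (P ∩ A (fs v)) (suc k)
  tail v = begin
    𝟙 (P fz) * U v + V v
      ≡⟨ cong (_+ V v) (𝟙-∧-swap (P fz) (P (fs v)) (A fz (fs v)) _) ⟩
    𝟙 (P (fs v)) * (𝟙 (P fz ∧ A fz (fs v)) * kcliques (A ⁺) (((P ∩ A fz) ∘ fs) ∩ (A ⁺) v) k) + V v
      ≡⟨ cong (λ t → 𝟙 (P (fs v)) * t + V v) (cong₂ (λ s t → 𝟙 (P fz ∧ s) * t) (A-sym fz (fs v))
           (kcliques-cong (A ⁺) (λ i → shuffle (P (fs i)) (A fz (fs i)) (A (fs v) (fs i))) k)) ⟩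
    𝟙 (P (fs v)) * (𝟙 (P fz ∧ A (fs v) fz) * kcliques (A ⁺) (((P ∩ A (fs v)) ∩ A fz) ∘ fs) k) + V v
      ≡⟨ *-distribˡ-+ (𝟙 (P (fs v))) _ _ ⟨
    𝟙 (P (fs v)) * kcliques A (P ∩ A (fs v)) (suc k) ∎

allCliques : ∀ {n} → (Fin n → Fin n → Bool) → (Fin n → Bool) → ℕ
allCliques {zero}  A P = 1
allCliques {suc n} A P = 𝟙 (P fz) * allCliques (A ⁺) ((P ∩ A fz) ∘ fs) + allCliques (A ⁺) (P ∘ fs)

countSubsets-none : ∀ {n} (p : Vec Bool n → Bool) → (∀ S → p S ≡ false) → countSubsets p ≡ 0
countSubsets-none {zero}  p h = cong 𝟙 (h [])
countSubsets-none {suc n} p h =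
  cong₂ _+_ (countSubsets-none (λ S → p (true ∷ S)) (λ S → h _)) (countSubsets-none (λ S → p (false ∷ S)) (λ S → h _))

record IsCliqueIn {n} (A : Fin n → Fin n → Bool) (P : Fin n → Bool) (S : Vec Bool n) : Set where
  field
    inside : ∀ i → lookup S i ≡ true → P i ≡ true
    joined : ∀ i j → ¬ i ≡ j → lookup S i ≡ true → lookup S j ≡ true → A i j ≡ true

open IsCliqueIn

-- The test `p` is arbitrary because `isClique` with the membership of vertex 0 fixed is no longer
-- an `isClique` of a smaller graph.
countSubsets≤allCliques : ∀ {n} (A : Fin n → Fin n → Bool) P (p : Vec Bool n → Bool) →
  (∀ S → p S ≡ true → IsCliqueIn A P S) → countSubsets p ≤ allCliques A P
countSubsets≤allCliques {zero}  A P p h = 𝟙≤1 (p [])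
countSubsets≤allCliques {suc n} A P p h = +-mono-≤ with-0
  (countSubsets≤allCliques (A ⁺) (P ∘ fs) _ λ S q → record
    { inside = λ i → inside (h _ q) (fs i)
    ; joined = λ i j i≢j → joined (h _ q) (fs i) (fs j) (i≢j ∘ Fin.suc-injective) })
  where
  with-0 : countSubsets (λ S → p (true ∷ S)) ≤ 𝟙 (P fz) * allCliques (A ⁺) ((P ∩ A fz) ∘ fs)
  with-0 with bool-cases (P fz)
  ... | inj₂ P0 = ≤-trans (≤-reflexive (countSubsets-none (λ S → p (true ∷ S)) λ S →
      ≢true λ q → ⊥-bool (inside (h (true ∷ S) q) fz refl) P0)) z≤n
  ... | inj₁ P0 rewrite P0 = ≤-trans (countSubsets≤allCliques (A ⁺) ((P ∩ A fz) ∘ fs) _ λ S q → record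
      { inside = λ i s → ∧-intro (inside (h _ q) (fs i) s) (joined (h _ q) fz (fs i) (λ ()) refl s)
      ; joined = λ i j i≢j → joined (h _ q) (fs i) (fs j) (i≢j ∘ Fin.suc-injective) })
    (m≤m+n _ 0)

cliques≤allCliques : ∀ {n} (G : Graph n) → cliques G ≤ allCliques (adj G) (λ _ → true)
cliques≤allCliques {n} G = countSubsets≤allCliques (adj G) _ (isClique G) λ S c → record
  { inside = λ _ _ → refl
  ; joined = λ i j i≢j si sj → pick i≢j si sj
      (allFinB-elim (λ j → not (lookup S i ∧ lookup S j) ∨ (i == j) ∨ adj G i j)
        (allFinB-elim (λ i → allFinB λ j → not (lookup S i ∧ lookup S j) ∨ (i == j) ∨ adj G i j) c i) j)
  }
  where
  pick : ∀ {i j} {s t} → ¬ i ≡ j → s ≡ true → t ≡ true →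
    not (s ∧ t) ∨ (i == j) ∨ adj G i j ≡ true → adj G i j ≡ true
  pick {i} {j} i≢j refl refl c with ∨-true {i == j} c
  ... | inj₁ e = ⊥-elim (i≢j (≡ᵇ-sound e))
  ... | inj₂ a = a

kcliquesUpTo : ∀ {n} → (Fin n → Fin n → Bool) → (Fin n → Bool) → ℕ → ℕ
kcliquesUpTo A P zero    = 1
kcliquesUpTo A P (suc k) = kcliquesUpTo A P k + kcliques A P (suc k)

kcliquesUpTo-suc : ∀ {n} (A : Fin (suc n) → Fin (suc n) → Bool) P k →
  kcliquesUpTo A P (suc k) ≡
    𝟙 (P fz) * kcliquesUpTo (A ⁺) ((P ∩ A fz) ∘ fs) k + kcliquesUpTo (A ⁺) (P ∘ fs) (suc k)
kcliquesUpTo-suc A P zero = ar (𝟙 (P fz)) (kcliques (A ⁺) (P ∘ fs) 1)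
  where
  ar : ∀ p x → 1 + (p * 1 + x) ≡ p * 1 + (1 + x)
  ar = solve-∀
kcliquesUpTo-suc A P (suc k) = trans (cong (_+ kcliques A P (2 + k)) (kcliquesUpTo-suc A P k))
  (ar (𝟙 (P fz)) (kcliquesUpTo (A ⁺) ((P ∩ A fz) ∘ fs) k) (kcliquesUpTo (A ⁺) (P ∘ fs) (suc k))
    (kcliques (A ⁺) ((P ∩ A fz) ∘ fs) (suc k)) (kcliques (A ⁺) (P ∘ fs) (2 + k)))
  where
  ar : ∀ p a b c d → p * a + b + (p * c + d) ≡ p * (a + c) + (b + d)
  ar = solve-∀

-- The vanishing passes to both branches: for cliques through vertex 0 with the size lowered by one,
-- for the others with the size unchanged. At size 1 it excludes vertex 0 from `P`.
allCliques≤kcliquesUpTo : ∀ {n} (A : Fin n → Fin n → Bool) P k → kcliques A P (suc k) ≡ 0 →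
  allCliques A P ≤ kcliquesUpTo A P k
allCliques≤kcliquesUpTo {zero}  A P k _ = positive k
  where
  positive : ∀ k → 1 ≤ kcliquesUpTo A P k
  positive zero    = ≤-refl
  positive (suc k) = ≤-trans (positive k) (m≤m+n _ _)
allCliques≤kcliquesUpTo {suc n} A P zero h with P fz
... | false = allCliques≤kcliquesUpTo (A ⁺) (P ∘ fs) 0 h
allCliques≤kcliquesUpTo {suc n} A P (suc k) h =
  ≤-trans (+-mono-≤ (with-0 (m+n≡0⇒m≡0 _ h)) (allCliques≤kcliquesUpTo (A ⁺) (P ∘ fs) (suc k) (m+n≡0⇒n≡0 _ h)))
    (≤-reflexive (sym (kcliquesUpTo-suc A P k)))
  where
  with-0 : 𝟙 (P fz) * kcliques (A ⁺) ((P ∩ A fz) ∘ fs) (suc k) ≡ 0 →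
    𝟙 (P fz) * allCliques (A ⁺) ((P ∩ A fz) ∘ fs) ≤ 𝟙 (P fz) * kcliquesUpTo (A ⁺) ((P ∩ A fz) ∘ fs) k
  with-0 e with P fz
  ... | false = z≤n
  ... | true  = *-monoʳ-≤ 1 (allCliques≤kcliquesUpTo (A ⁺) ((P ∩ A fz) ∘ fs) k (trans (sym (+-identityʳ _)) e))

-- Neighbourhoods in planar graphs

anyFinB-intro : ∀ {n} (p : Fin n → Bool) {i} → p i ≡ true → anyFinB p ≡ true
anyFinB-intro p {fz}   h = ∨-introˡ h
anyFinB-intro p {fs i} h = ∨-introʳ {p fz} (anyFinB-intro (p ∘ fs) h)

module PlanarGraph {n} (G : Graph n) (R : Rotation G)
  (euler : n + faces R + isolated G ≡ 2 * components G + edges G) where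

  open Embedding G R using (IsSubgraph; isDart)
  open Sparsity G R

  private
    a : Fin n → Fin n → Bool
    a = adj G

    a-sym : ∀ {u v} → a u v ≡ true → a v u ≡ true
    a-sym p = trans (adj-sym G _ _) p

    a-irr : ∀ {u v} → a u v ≡ true → ¬ u ≡ v
    a-irr {u} p refl = ⊥-bool p (adj-irrefl G u)

  induced : (Fin n → Bool) → Dart n → Bool
  induced P (u , v) = P u ∧ (P v ∧ a u v)

  induced-intro : ∀ P {u v} → P u ≡ true → P v ≡ true → a u v ≡ true → induced P (u , v) ≡ true
  induced-intro P p q r = ∧-intro p (∧-intro q r)

  induced-elim : ∀ P {u v} → induced P (u , v) ≡ true → P u ≡ true × P v ≡ true × a u v ≡ true
  induced-elim P p = let (q , r) = ∧-true p in q , ∧-true r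

  induced-isSubgraph : ∀ P → IsSubgraph (induced P)
  induced-isSubgraph P = record
    { symmetric = λ (u , v) → true⇔⇒≡ (flip v u) (flip u v)
    ; ⊆-darts   = λ (u , v) p → proj₂ (proj₂ (induced-elim P {u} {v} p))
    }
    where
    flip : ∀ u v → induced P (u , v) ≡ true → induced P (v , u) ≡ true
    flip u v p = let (q , r , s) = induced-elim P {u} {v} p in induced-intro P r q (a-sym s)

  -- Twice the number of edges of the subgraph induced by P.
  E : (Fin n → Bool) → ℕ
  E P = count (induced P)

  degree : (Fin n → Bool) → Fin n → ℕ
  degree P v = count (P ∩ a v)

  E-degrees : ∀ P → E P ≡ ∑[ v ] 𝟙 (P v) * degree P v
  E-degrees P = trans (∑-× _) (∑-cong λ v → trans (∑-cong λ w → 𝟙-∧ (P v) _) (∑-* (𝟙 (P v)) _))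

  E-empty : ∀ P → (∀ v → P v ≡ false) → E P ≡ 0
  E-empty P h = ∑-≡0 λ (u , v) → cong 𝟙 (≢true λ p → ⊥-bool (proj₁ (induced-elim P {u} {v} p)) (h u))

  cone : Fin n → (Fin n → Bool) → Fin n → Bool
  cone v Z x = (v ≡ᵇ x) ∨ Z x

  apex : ∀ v Z → cone v Z v ≡ true
  apex v Z = ∨-introˡ (≡ᵇ-complete {x = v} refl)

  base : ∀ v Z {x} → Z x ≡ true → cone v Z x ≡ true
  base v Z {x} = ∨-introʳ {v ≡ᵇ x}

  cone-elim : ∀ v Z {x} → cone v Z x ≡ true → v ≡ x ⊎ Z x ≡ true
  cone-elim v Z {x} p with ∨-true {v ≡ᵇ x} p
  ... | inj₁ e = inj₁ (≡ᵇ-sound e)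
  ... | inj₂ q = inj₂ q

  _⊆N_ : (Fin n → Bool) → Fin n → Set
  Z ⊆N v = ∀ x → Z x ≡ true → a v x ≡ true

  cone⊆N : ∀ {u v Z} → a v u ≡ true → Z ⊆N v → cone u Z ⊆N v
  cone⊆N {u} {v} {Z} vu h x p with cone-elim u Z p
  ... | inj₁ refl = vu
  ... | inj₂ q    = h x q

  module _ {v Z} (Z⊆N : Z ⊆N v) where

    private
      𝟙-cone : ∀ x → 𝟙 (cone v Z x) ≡ 𝟙 (v ≡ᵇ x) + 𝟙 (Z x)
      𝟙-cone x with v ≟ x
      ... | no _     = refl
      ... | yes refl = cong (λ b → 1 + 𝟙 b) (sym (≢true λ p → a-irr (Z⊆N v p) refl))

    count-cone : count (cone v Z) ≡ 1 + count Z
    count-cone = trans (∑-cong 𝟙-cone) (trans (∑-+ _ _) (cong (_+ count Z) (count-≡ᵇ v)))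

    degree-cone : ∀ x → degree (cone v Z) x ≡ 𝟙 (a x v) + degree Z x
    degree-cone x = begin
      degree (cone v Z) x                                  ≡⟨ ∑-cong pt ⟩
      ∑[ y ] (𝟙 (v ≡ᵇ y) * 𝟙 (a x y) + 𝟙 ((Z ∩ a x) y))    ≡⟨ ∑-+ _ _ ⟩
      (∑[ y ] 𝟙 (v ≡ᵇ y) * 𝟙 (a x y)) + degree Z x         ≡⟨ cong (_+ degree Z x) (∑-δ v _) ⟩
      𝟙 (a x v) + degree Z x                               ∎
      where
      open ≡-Reasoning
      pt : ∀ y → 𝟙 ((cone v Z ∩ a x) y) ≡ 𝟙 (v ≡ᵇ y) * 𝟙 (a x y) + 𝟙 ((Z ∩ a x) y)
      pt y = begin
        𝟙 (cone v Z y ∧ a x y)                           ≡⟨ 𝟙-∧ (cone v Z y) (a x y) ⟩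
        𝟙 (cone v Z y) * 𝟙 (a x y)                       ≡⟨ cong (_* 𝟙 (a x y)) (𝟙-cone y) ⟩
        (𝟙 (v ≡ᵇ y) + 𝟙 (Z y)) * 𝟙 (a x y)               ≡⟨ *-distribʳ-+ (𝟙 (a x y)) (𝟙 (v ≡ᵇ y)) _ ⟩
        𝟙 (v ≡ᵇ y) * 𝟙 (a x y) + 𝟙 (Z y) * 𝟙 (a x y)
          ≡⟨ cong (𝟙 (v ≡ᵇ y) * 𝟙 (a x y) +_) (𝟙-∧ (Z y) (a x y)) ⟨
        𝟙 (v ≡ᵇ y) * 𝟙 (a x y) + 𝟙 (Z y ∧ a x y)         ∎

    E-cone : E (cone v Z) ≡ E Z + 2 * count Z
    E-cone = begin
      E (cone v Z)                                               ≡⟨ E-degrees (cone v Z) ⟩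
      ∑[ x ] 𝟙 (cone v Z x) * degree (cone v Z) x                ≡⟨ ∑-cong pt ⟩
      ∑[ x ] (𝟙 (v ≡ᵇ x) * d x + (𝟙 (Z x) + 𝟙 (Z x) * degree Z x)) ≡⟨ ∑-+ _ _ ⟩
      (∑[ x ] 𝟙 (v ≡ᵇ x) * d x) + (∑[ x ] (𝟙 (Z x) + 𝟙 (Z x) * degree Z x))
        ≡⟨ cong₂ _+_ (∑-δ v d) (∑-+ _ _) ⟩
      d v + (count Z + (∑[ x ] 𝟙 (Z x) * degree Z x))
        ≡⟨ cong₂ (λ s t → s + (count Z + t)) dv (sym (E-degrees Z)) ⟩
      count Z + (count Z + E Z)                                  ≡⟨ ar (count Z) (E Z) ⟩
      E Z + 2 * count Z                                          ∎
      where
      open ≡-Reasoning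
      d : Fin n → ℕ
      d x = 𝟙 (a x v) + degree Z x
      ar : ∀ z e → z + (z + e) ≡ e + 2 * z
      ar = solve-∀
      pt : ∀ x → 𝟙 (cone v Z x) * degree (cone v Z) x ≡ 𝟙 (v ≡ᵇ x) * d x + (𝟙 (Z x) + 𝟙 (Z x) * degree Z x)
      pt x = begin
        𝟙 (cone v Z x) * degree (cone v Z) x       ≡⟨ cong₂ _*_ (𝟙-cone x) (degree-cone x) ⟩
        (𝟙 (v ≡ᵇ x) + 𝟙 (Z x)) * d x               ≡⟨ *-distribʳ-+ (d x) (𝟙 (v ≡ᵇ x)) _ ⟩
        𝟙 (v ≡ᵇ x) * d x + 𝟙 (Z x) * d x           ≡⟨ cong (𝟙 (v ≡ᵇ x) * d x +_) tail ⟩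
        𝟙 (v ≡ᵇ x) * d x + (𝟙 (Z x) + 𝟙 (Z x) * degree Z x) ∎
        where
        tail : 𝟙 (Z x) * d x ≡ 𝟙 (Z x) + 𝟙 (Z x) * degree Z x
        tail with bool-cases (Z x)
        ... | inj₁ p rewrite p | a-sym (Z⊆N x p) = refl
        ... | inj₂ p rewrite p = refl
      dv : d v ≡ count Z
      dv rewrite adj-irrefl G v = ∑-cong λ y → cong 𝟙 (true⇔⇒≡ (proj₁ ∘ ∧-true) (λ p → ∧-intro p (Z⊆N y p)))

    -- Sparsity of the cone with apex `v`, which has 1 + |Z| vertices and |Z| spokes. Two vertices
    -- in `Z` make it branching: a spoke continues along another spoke, an edge inside `Z` continues
    -- to the apex.
    link-sparse₁ : ∀ {x y} → Z x ≡ true → Z y ≡ true → ¬ x ≡ y → E Z + 6 ≤ 4 * count Z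
    link-sparse₁ {x} {y} Zx Zy x≢y = +-cancelʳ-≤ (2 * count Z + 6) _ _ (begin
      E Z + 6 + (2 * count Z + 6)                ≡⟨ ar₁ (E Z) (count Z) ⟩
      (E Z + 2 * count Z) + 12                   ≡⟨ cong (_+ 12) E-cone ⟨
      count (induced (cone v Z)) + 12
        ≤⟨ planar-sparse euler (induced-isSubgraph (cone v Z)) branching (spoke Zx) ⟩
      6 * count (not ∘ lonely (induced (cone v Z))) ≤⟨ *-monoʳ-≤ 6 (∑-mono λ u → 𝟙-mono (in-cone u)) ⟩
      6 * count (cone v Z)                       ≡⟨ cong (6 *_) count-cone ⟩
      6 * (1 + count Z)                          ≡⟨ ar₂ (count Z) ⟩
      4 * count Z + (2 * count Z + 6)            ∎)
      where
      open ≤-Reasoning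
      ar₁ : ∀ e z → e + 6 + (2 * z + 6) ≡ (e + 2 * z) + 12
      ar₁ = solve-∀
      ar₂ : ∀ z → 6 * (1 + z) ≡ 4 * z + (2 * z + 6)
      ar₂ = solve-∀
      spoke : ∀ {z} → Z z ≡ true → induced (cone v Z) (v , z) ≡ true
      spoke {z} p = induced-intro (cone v Z) (apex v Z) (base v Z p) (Z⊆N z p)
      other : ∀ w → ∃[ c ] (Z c ≡ true × ¬ c ≡ w)
      other w with x ≟ w
      ... | no ¬p    = x , Zx , ¬p
      ... | yes refl = y , Zy , x≢y ∘ sym
      branching : Branching (induced (cone v Z))
      branching p q pq with induced-elim (cone v Z) {p} {q} pq
      ... | p∈ , q∈ , pq′ with cone-elim v Z q∈
      ...   | inj₁ refl = let (c , Zc , c≢p) = other p in inj₁ (c , spoke Zc , c≢p)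
      ...   | inj₂ Zq with cone-elim v Z p∈
      ...     | inj₁ refl = let (c , Zc , c≢q) = other q in inj₂ (c , spoke Zc , c≢q)
      ...     | inj₂ Zp   = inj₁ (v , induced-intro (cone v Z) q∈ (apex v Z) (a-sym (Z⊆N q Zq)) , a-irr (Z⊆N p Zp))
      in-cone : ∀ u → not (lonely (induced (cone v Z)) u) ≡ true → cone v Z u ≡ true
      in-cone u p = let (w , q) = neighbour (induced (cone v Z)) (not-true p) in
        proj₁ (induced-elim (cone v Z) {u} {w} q)

  -- `cone u Z` lies in the neighbourhood of `v` and has the two vertices `u` and `z`, so
  -- `link-sparse₁` applies to it.
  link-sparse₂ : ∀ {u v Z} → a u v ≡ true → Z ⊆N u → Z ⊆N v → ∀ {z} → Z z ≡ true → E Z + 2 ≤ 2 * count Z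
  link-sparse₂ {u} {v} {Z} uv hu hv {z} Zz = +-cancelʳ-≤ (2 * count Z + 4) _ _ (begin
    E Z + 2 + (2 * count Z + 4)      ≡⟨ ar₁ (E Z) (count Z) ⟩
    (E Z + 2 * count Z) + 6          ≡⟨ cong (_+ 6) (E-cone hu) ⟨
    E (cone u Z) + 6
      ≤⟨ link-sparse₁ (cone⊆N {Z = Z} (a-sym uv) hv) (apex u Z) (base u Z Zz) (a-irr (hu z Zz)) ⟩
    4 * count (cone u Z)             ≡⟨ cong (4 *_) (count-cone hu) ⟩
    4 * (1 + count Z)                ≡⟨ ar₂ (count Z) ⟩
    2 * count Z + (2 * count Z + 4)  ∎)
    where
    open ≤-Reasoning
    ar₁ : ∀ e z → e + 2 + (2 * z + 4) ≡ (e + 2 * z) + 6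
    ar₁ = solve-∀
    ar₂ : ∀ z → 4 * (1 + z) ≡ 2 * z + (2 * z + 4)
    ar₂ = solve-∀

  -- `cone w Z` lies in the common neighbourhood of `u` and `v`, and `w` is the vertex that
  -- `link-sparse₂` asks for.
  link-sparse₃ : ∀ {u v w Z} → a u v ≡ true → a u w ≡ true → a v w ≡ true →
    Z ⊆N u → Z ⊆N v → Z ⊆N w → E Z ≡ 0
  link-sparse₃ {u} {v} {w} {Z} uv uw vw hu hv hw = n≤0⇒n≡0 (+-cancelʳ-≤ (2 * count Z + 2) _ _ (begin
    E Z + (2 * count Z + 2)          ≡⟨ +-assoc (E Z) _ 2 ⟨
    E Z + 2 * count Z + 2            ≡⟨ cong (_+ 2) (E-cone hw) ⟨
    E (cone w Z) + 2
      ≤⟨ link-sparse₂ uv (cone⊆N {Z = Z} uw hu) (cone⊆N {Z = Z} vw hv) (apex w Z) ⟩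
    2 * count (cone w Z)             ≡⟨ cong (2 *_) (count-cone hw) ⟩
    2 * (1 + count Z)                ≡⟨ ar (count Z) ⟩
    0 + (2 * count Z + 2)            ∎))
    where
    open ≤-Reasoning
    ar : ∀ z → 2 * (1 + z) ≡ 0 + (2 * z + 2)
    ar = solve-∀

  -- Counting triangles and 4-cliques

  K : (Fin n → Bool) → ℕ → ℕ
  K = kcliques a

  K-double-count : ∀ P k → suc k * K P (suc k) ≡ ∑[ v ] 𝟙 (P v) * K (P ∩ a v) k
  K-double-count = kcliques-double-count a (adj-sym G) (adj-irrefl G)

  K₁ : ∀ P → K P 1 ≡ count P
  K₁ P = trans (sym (+-identityʳ _)) (trans (K-double-count P 0) (∑-cong λ v → *-identityʳ _))

  K₂ : ∀ P → 2 * K P 2 ≡ E P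
  K₂ P = trans (K-double-count P 1) (trans (∑-cong λ v → cong (𝟙 (P v) *_) (K₁ (P ∩ a v))) (sym (E-degrees P)))

  private
    𝟙*-≡0 : ∀ b {k} → (b ≡ true → k ≡ 0) → 𝟙 b * k ≡ 0
    𝟙*-≡0 true  h = trans (+-identityʳ _) (h refl)
    𝟙*-≡0 false h = refl

    K-step-0 : ∀ P k → (∀ v → P v ≡ true → K (P ∩ a v) k ≡ 0) → K P (suc k) ≡ 0
    K-step-0 P k h = m+n≡0⇒m≡0 _ (trans (K-double-count P k) (∑-≡0 λ v → 𝟙*-≡0 (P v) (h v)))

  everything : Fin n → Bool
  everything _ = true

  no-5-cliques : K everything 5 ≡ 0
  no-5-cliques =
    K-step-0 everything 4 λ u _ → K-step-0 (a u) 3 λ v uv → K-step-0 (a u ∩ a v) 2 λ w uvw →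
    let (uw , vw) = ∧-true uvw
        Z = (a u ∩ a v) ∩ a w
    in m+n≡0⇒m≡0 _ (trans (K₂ Z) (link-sparse₃ {Z = Z} uv uw vw
         (λ x p → proj₁ (∧-true (proj₁ (∧-true {a u x ∧ a v x} p))))
         (λ x p → proj₂ (∧-true {a u x} (proj₁ (∧-true {a u x ∧ a v x} p))))
         (λ x p → proj₂ (∧-true {a u x ∧ a v x} p))))

  inTriangle : Dart n → Bool
  inTriangle (u , v) = a u v ∧ anyFinB (a u ∩ a v)

  inTriangle-intro : ∀ {u v w} → a u v ≡ true → a u w ≡ true → a v w ≡ true → inTriangle (u , v) ≡ true
  inTriangle-intro {u} {v} uv uw vw = ∧-intro uv (anyFinB-intro (a u ∩ a v) (∧-intro uw vw))

  inTriangle-elim : ∀ u v → inTriangle (u , v) ≡ true → a u v ≡ true × ∃[ w ] (a u w ≡ true × a v w ≡ true)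
  inTriangle-elim u v p =
    let (uv , q) = ∧-true {a u v} p; (w , r) = anyFinB-elim (a u ∩ a v) q in uv , w , ∧-true r

  -- In the notation of the overview these are 2m′, n′, 6k₃ and 24k₄: edges, triangles and 4-cliques
  -- counted with an ordering of their vertices.
  M N T₃ T₄ : ℕ
  M  = count inTriangle
  N  = count (not ∘ lonely inTriangle)
  T₃ = ∑[ v ] E (a v)
  T₄ = ∑[ v ] ∑[ w ] 𝟙 (a v w) * E (a v ∩ a w)

  M-bound : ∀ {u v} → inTriangle (u , v) ≡ true → M + 12 ≤ 6 * N
  M-bound = planar-sparse euler isSub branching
    where
    flip : ∀ u v → inTriangle (u , v) ≡ true → inTriangle (v , u) ≡ true
    flip u v p = let (uv , w , uw , vw) = inTriangle-elim u v p in inTriangle-intro (a-sym uv) vw uw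
    isSub : IsSubgraph inTriangle
    isSub = record
      { symmetric = λ (u , v) → true⇔⇒≡ (flip v u) (flip u v)
      ; ⊆-darts   = λ (u , v) p → proj₁ (inTriangle-elim u v p)
      }
    branching : Branching inTriangle
    branching u v p = let (uv , w , uw , vw) = inTriangle-elim u v p in
      inj₁ (w , inTriangle-intro vw (a-sym uv) (a-sym uw) , a-irr uw ∘ sym)

  -- `link-sparse₁` summed over the vertices in triangles. An edge inside the neighbourhood of `v`
  -- has both ends in `Z v`, so passing to `Z v` loses no edge, while the sizes of the `Z v` add up
  -- to `M`.
  T₃-bound : T₃ + 6 * N ≤ 4 * M
  T₃-bound = begin
    T₃ + 6 * N                                              ≡⟨ cong (T₃ +_) (∑-* 6 _) ⟨
    T₃ + (∑[ v ] 6 * 𝟙 (not (lonely inTriangle v)))         ≡⟨ ∑-+ _ _ ⟨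
    ∑[ v ] (E (a v) + 6 * 𝟙 (not (lonely inTriangle v)))    ≤⟨ ∑-mono pt ⟩
    ∑[ v ] 4 * count (Z v)                                  ≡⟨ ∑-* 4 _ ⟩
    4 * (∑[ v ] count (Z v))                                ≡⟨ cong (4 *_) (∑-× _) ⟨
    4 * M                                                   ∎
    where
    open ≤-Reasoning
    Z : Fin n → Fin n → Bool
    Z v w = inTriangle (v , w)
    E≤ : ∀ v → E (a v) ≤ E (Z v)
    E≤ v = ∑-mono λ (x , y) → 𝟙-mono λ p → let (vx , vy , xy) = induced-elim (a v) {x} {y} p in
      induced-intro (Z v) (inTriangle-intro vx vy xy) (inTriangle-intro vy vx (a-sym xy)) xy
    pt : ∀ v → E (a v) + 6 * 𝟙 (not (lonely inTriangle v)) ≤ 4 * count (Z v)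
    pt v with bool-cases (lonely inTriangle v)
    ... | inj₁ l rewrite l = ≤-trans (≤-reflexive (+-identityʳ _)) (≤-trans (E≤ v)
          (≤-trans (≤-reflexive (E-empty (Z v) λ w → lonely-elim inTriangle l)) z≤n))
    ... | inj₂ l rewrite l with neighbour inTriangle l
    ...   | w , p with inTriangle-elim v w p
    ...     | vw , x , vx , wx = ≤-trans (+-monoˡ-≤ 6 (E≤ v))
      (link-sparse₁ {v} {Z v} (λ y q → proj₁ (inTriangle-elim v y q)) p (inTriangle-intro vx vw (a-sym wx)) (a-irr wx))

  -- `link-sparse₂` summed over the darts in triangles; the sizes of the common neighbourhoods add
  -- up to `T₃`.
  T₄-bound : T₄ + 2 * M ≤ 2 * T₃
  T₄-bound = begin
    T₄ + 2 * M
      ≡⟨ cong (λ t → T₄ + 2 * t) (∑-× _) ⟩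
    T₄ + 2 * (∑[ v ] ∑[ w ] 𝟙 (inTriangle (v , w)))
      ≡⟨ cong (T₄ +_) (trans (∑-cong λ v → ∑-* 2 _) (∑-* 2 _)) ⟨
    T₄ + (∑[ v ] ∑[ w ] 2 * 𝟙 (inTriangle (v , w)))
      ≡⟨ trans (∑-cong λ v → ∑-+ _ _) (∑-+ _ _) ⟨
    ∑[ v ] ∑[ w ] (𝟙 (a v w) * E (a v ∩ a w) + 2 * 𝟙 (inTriangle (v , w)))
      ≤⟨ ∑-mono (λ v → ∑-mono (pt v)) ⟩
    ∑[ v ] ∑[ w ] 2 * (𝟙 (a v w) * count (a v ∩ a w))
      ≡⟨ trans (∑-cong λ v → ∑-* 2 _) (∑-* 2 _) ⟩
    2 * (∑[ v ] ∑[ w ] 𝟙 (a v w) * count (a v ∩ a w))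
      ≡⟨ cong (2 *_) (∑-cong λ v → E-degrees (a v)) ⟨
    2 * T₃ ∎
    where
    open ≤-Reasoning
    pt : ∀ v w → 𝟙 (a v w) * E (a v ∩ a w) + 2 * 𝟙 (inTriangle (v , w)) ≤ 2 * (𝟙 (a v w) * count (a v ∩ a w))
    pt v w with bool-cases (a v w)
    ... | inj₂ vw rewrite vw = z≤n
    ... | inj₁ vw with bool-cases (inTriangle (v , w))
    ...   | inj₂ t rewrite t | vw | E-empty (a v ∩ a w) (λ x → ≢true λ p →
              ⊥-bool (anyFinB-intro (a v ∩ a w) {x} p) t) = z≤n
    ...   | inj₁ t with inTriangle-elim v w t
    ...     | _ , x , vx , wx rewrite t | vw | +-identityʳ (E (a v ∩ a w)) | +-identityʳ (count (a v ∩ a w)) =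
      link-sparse₂ {Z = a v ∩ a w} vw (λ y → proj₁ ∘ ∧-true) (λ y → proj₂ ∘ ∧-true {a v y})
        (∧-intro vx wx)

  M≤2edges : M ≤ 2 * edges G
  M≤2edges = ≤-trans (∑-mono λ (u , v) → 𝟙-mono λ p → proj₁ (∧-true {a u v} p)) (≤-reflexive (handshake G))

  vertices : K everything 1 ≡ n
  vertices = trans (K₁ everything) (count-all n)

  2-cliques : K everything 2 ≡ edges G
  2-cliques = *-cancelˡ-≡ _ _ 2 (trans (K₂ everything) (handshake G))

  3-cliques : 6 * K everything 3 ≡ T₃
  3-cliques = begin
    6 * K everything 3                     ≡⟨ *-assoc 2 3 (K everything 3) ⟩
    2 * (3 * K everything 3)               ≡⟨ cong (2 *_) (K-double-count everything 2) ⟩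
    2 * (∑[ v ] 1 * K (a v) 2)             ≡⟨ ∑-* 2 _ ⟨
    ∑[ v ] 2 * (1 * K (a v) 2)
      ≡⟨ ∑-cong (λ v → trans (cong (2 *_) (*-identityˡ (K (a v) 2))) (K₂ (a v))) ⟩
    T₃                                     ∎
    where open ≡-Reasoning

  4-cliques : 24 * K everything 4 ≡ T₄
  4-cliques = begin
    24 * K everything 4                    ≡⟨ *-assoc 6 4 (K everything 4) ⟩
    6 * (4 * K everything 4)               ≡⟨ cong (6 *_) (K-double-count everything 3) ⟩
    6 * (∑[ v ] 1 * K (a v) 3)             ≡⟨ ∑-* 6 _ ⟨
    ∑[ v ] 6 * (1 * K (a v) 3)             ≡⟨ ∑-cong row ⟩
    T₄                                     ∎
    where
    open ≡-Reasoning
    swap-* : ∀ x y → 2 * (x * y) ≡ x * (2 * y)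
    swap-* = solve-∀
    row : ∀ v → 6 * (1 * K (a v) 3) ≡ ∑[ w ] 𝟙 (a v w) * E (a v ∩ a w)
    row v = begin
      6 * (1 * K (a v) 3)                          ≡⟨ cong (6 *_) (*-identityˡ (K (a v) 3)) ⟩
      6 * K (a v) 3                                ≡⟨ *-assoc 2 3 (K (a v) 3) ⟩
      2 * (3 * K (a v) 3)                          ≡⟨ cong (2 *_) (K-double-count (a v) 2) ⟩
      2 * (∑[ w ] 𝟙 (a v w) * K (a v ∩ a w) 2)     ≡⟨ ∑-* 2 _ ⟨
      ∑[ w ] 2 * (𝟙 (a v w) * K (a v ∩ a w) 2)
        ≡⟨ ∑-cong (λ w → trans (swap-* (𝟙 (a v w)) _) (cong (𝟙 (a v w) *_) (K₂ (a v ∩ a w)))) ⟩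
      ∑[ w ] 𝟙 (a v w) * E (a v ∩ a w)             ∎

  large-cliques : 3 ≤ edges G → 3 * (K everything 3 + K everything 4) + 9 ≤ 4 * edges G
  large-cliques 3≤m with findᵇ inTriangle
  ... | inj₂ none = begin
    3 * (k₃ + k₄) + 9    ≡⟨ cong (λ t → 3 * t + 9) (cong₂ _+_ k₃≡0 k₄≡0) ⟩
    -- Without triangles the claim rests on the number of edges: 9 ≤ 12 ≤ 4m.
    9                    ≤⟨ ≤-trans (m≤m+n 9 3) (*-monoʳ-≤ 4 3≤m) ⟩
    4 * edges G          ∎
    where
    open ≤-Reasoning
    k₃ = K everything 3
    k₄ = K everything 4
    M≡0 : M ≡ 0
    M≡0 = ∑-≡0 λ x → cong 𝟙 (none x)
    T₃≡0 : T₃ ≡ 0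
    T₃≡0 = m+n≡0⇒m≡0 T₃ (n≤0⇒n≡0 (≤-trans T₃-bound (≤-reflexive (cong (4 *_) M≡0))))
    T₄≡0 : T₄ ≡ 0
    T₄≡0 = m+n≡0⇒m≡0 T₄ (n≤0⇒n≡0 (≤-trans T₄-bound (≤-reflexive (cong (2 *_) T₃≡0))))
    k₃≡0 : k₃ ≡ 0
    k₃≡0 = m+n≡0⇒m≡0 k₃ (trans 3-cliques T₃≡0)
    k₄≡0 : k₄ ≡ 0
    k₄≡0 = m+n≡0⇒m≡0 k₄ (trans 4-cliques T₄≡0)
  -- The factor 24 turns the clique numbers into 12 `T₃` + 3 `T₄`. Three times `T₄-bound` raises the
  -- former to 18 `T₃`, which sets the weight of `T₃-bound`; its 108 `N` then sets the weight 18 of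
  -- `M-bound`, whose 18 · 12 is 24 · 9.
  ... | inj₁ ((u , v) , uv) = *-cancelˡ-≤ 24 (+-cancelʳ-≤ (24 * M + 108 * N + 6 * T₃) _ _ (begin
    24 * (3 * (k₃ + k₄) + 9) + (24 * M + 108 * N + 6 * T₃)    ≡⟨ ar₁ k₃ k₄ M N T₃ ⟩
    12 * (6 * k₃) + 3 * (24 * k₄) + (216 + 24 * M + 108 * N + 6 * T₃)
      ≡⟨ cong₂ (λ s t → 12 * s + 3 * t + (216 + 24 * M + 108 * N + 6 * T₃)) 3-cliques 4-cliques ⟩
    12 * T₃ + 3 * T₄ + (216 + 24 * M + 108 * N + 6 * T₃)      ≡⟨ ar₂ T₃ T₄ M N ⟩
    3 * (T₄ + 2 * M) + (18 * (T₃ + 6 * N) + 18 * (M + 12))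
      ≤⟨ +-mono-≤ (*-monoʳ-≤ 3 T₄-bound) (+-mono-≤ (*-monoʳ-≤ 18 T₃-bound) (*-monoʳ-≤ 18 (M-bound uv))) ⟩
    3 * (2 * T₃) + (18 * (4 * M) + 18 * (6 * N))              ≡⟨ ar₃ T₃ M N ⟩
    48 * M + (24 * M + 108 * N + 6 * T₃)                      ≤⟨ +-monoˡ-≤ _ (*-monoʳ-≤ 48 M≤2edges) ⟩
    48 * (2 * edges G) + (24 * M + 108 * N + 6 * T₃)
      ≡⟨ cong (_+ (24 * M + 108 * N + 6 * T₃)) (ar₄ (edges G)) ⟩
    24 * (4 * edges G) + (24 * M + 108 * N + 6 * T₃)          ∎))
    where
    open ≤-Reasoning
    k₃ = K everything 3
    k₄ = K everything 4
    ar₁ : ∀ k₃ k₄ M N T → 24 * (3 * (k₃ + k₄) + 9) + (24 * M + 108 * N + 6 * T) ≡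
      12 * (6 * k₃) + 3 * (24 * k₄) + (216 + 24 * M + 108 * N + 6 * T)
    ar₁ = solve-∀
    ar₂ : ∀ T₃ T₄ M N → 12 * T₃ + 3 * T₄ + (216 + 24 * M + 108 * N + 6 * T₃) ≡
      3 * (T₄ + 2 * M) + (18 * (T₃ + 6 * N) + 18 * (M + 12))
    ar₂ = solve-∀
    ar₃ : ∀ T M N → 3 * (2 * T) + (18 * (4 * M) + 18 * (6 * N)) ≡ 48 * M + (24 * M + 108 * N + 6 * T)
    ar₃ = solve-∀
    ar₄ : ∀ m → 48 * (2 * m) ≡ 24 * (4 * m)
    ar₄ = solve-∀

  cliques-bound : 3 ≤ edges G → 3 * cliques G + 6 ≤ 3 * n + 7 * edges G
  cliques-bound 3≤m = begin
    3 * cliques G + 6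
      ≤⟨ +-monoˡ-≤ 6 (*-monoʳ-≤ 3 (≤-trans (cliques≤allCliques G)
                                                               (allCliques≤kcliquesUpTo a everything 4 no-5-cliques))) ⟩
    3 * (1 + K everything 1 + K everything 2 + k₃ + k₄) + 6
      ≡⟨ cong₂ (λ s t → 3 * (1 + s + t + k₃ + k₄) + 6) vertices 2-cliques ⟩
    3 * (1 + n + edges G + k₃ + k₄) + 6                   ≡⟨ ar₁ n (edges G) k₃ k₄ ⟩
    3 * n + 3 * edges G + (3 * (k₃ + k₄) + 9)
      ≤⟨ +-monoʳ-≤ (3 * n + 3 * edges G) (large-cliques 3≤m) ⟩
    3 * n + 3 * edges G + 4 * edges G                     ≡⟨ ar₂ n (edges G) ⟩
    3 * n + 7 * edges G                                   ∎
    where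
    open ≤-Reasoning
    k₃ = K everything 3
    k₄ = K everything 4
    ar₁ : ∀ n m k₃ k₄ → 3 * (1 + n + m + k₃ + k₄) + 6 ≡ 3 * n + 3 * m + (3 * (k₃ + k₄) + 9)
    ar₁ = solve-∀
    ar₂ : ∀ n m → 3 * n + 3 * m + 4 * m ≡ 3 * n + 7 * m
    ar₂ = solve-∀

theorem5 : (n : ℕ) (G : Graph n) → Planar G → 3 ≤ edges G →
    3 * cliques G + 6 ≤ 3 * n + 7 * edges G
theorem5 n G (R , euler) = PlanarGraph.cliques-bound G R euler
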